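{- Let $G$ be a connected signed eulerian graph. Then $\Phi(G)=3$ if and only if $G$ can be decomposed into three edge-disjoint eulerian subgraphs, each having an odd number of negative edges, that share a common vertex.
   Context: Graphs are finite and may have loops and multiple edges. A graph is eulerian if it is connected and every vertex has even valency. A signed graph is a graph with a signature $\sigma:E\to\{+1,-1\}$. Orientation: each edge has two half-edges; positive edges have exactly one half-edge pointing toward its end, negative edges have both pointing away or both toward their ends. A $\mathbb{Z}$-flow is $\xi:E\to\mathbb{Z}$ such that at each vertex the sum of values on half-edges directed out minus the sum on half-edges directed in is $0$. A nowhere-zero $k$-flow is a $\mathbb{Z}$-flow with values in $\{\pm1,\dots,\pm(k-1)\}$; the flow number $\Phi(G)$ is the least $k$ for which $G$ has a nowhere-zero $k$-flow. -}

module Defs where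

open import Data.Nat using (ℕ; zero; suc; _+_; _<_)
open import Data.Nat.Divisibility using (_∣_)
open import Data.Integer as ℤ using (ℤ; 0ℤ; -_; ∣_∣)
open import Data.Fin using (Fin; zero; suc; _≟_)
open import Data.Bool using (Bool; true; false; if_then_else_; _∧_)
open import Data.Sign using (Sign)
open import Data.Product using (Σ; ∃; _×_; _,_)
open import Relation.Nullary using (¬_; does)
open import Relation.Binary.PropositionalEquality using (_≡_; _≢_)

∑ : ∀ {m} → (Fin m → ℕ) → ℕ
∑ {zero}  f = 0
∑ {suc m} f = f zero + ∑ (λ i → f (suc i))

∑ℤ : ∀ {m} → (Fin m → ℤ) → ℤ
∑ℤ {zero}  f = 0ℤ
∑ℤ {suc m} f = f zero ℤ.+ ∑ℤ (λ i → f (suc i))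

-- A finite signed graph (loops and multiple edges allowed).
-- Vertices are Fin nV, edges Fin nE; edge e has two half-edges,
-- indexed by Bool, and  end e b  is the end vertex of half-edge b of e.
record SignedGraph : Set where
  field
    nV  : ℕ
    nE  : ℕ
    end : Fin nE → Bool → Fin nV
    σ   : Fin nE → Sign

module _ (G : SignedGraph) where
  open SignedGraph G

  EdgeSet : Set
  EdgeSet = Fin nE → Bool

  allEdges : EdgeSet
  allEdges _ = true

  -- number of half-edges of e whose end is v (a loop at v contributes 2)
  endsAt : Fin nE → Fin nV → ℕ
  endsAt e v = (if does (end e false ≟ v) then 1 else 0)
             + (if does (end e true ≟ v) then 1 else 0)

  deg : EdgeSet → Fin nV → ℕ
  deg S v = ∑ (λ e → if S e then endsAt e v else 0)

  data Walk (S : EdgeSet) : Fin nV → Fin nV → Set where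
    here : ∀ v → Walk S v v
    step : ∀ e b {w} → S e ≡ true →
           Walk S (end e (Data.Bool.not b)) w → Walk S (end e b) w

  -- v is a vertex of the edge-induced subgraph on S
  Incident : EdgeSet → Fin nV → Set
  Incident S v = ∃ λ e → S e ≡ true × ∃ λ b → end e b ≡ v

  Connected : Set
  Connected = (0 < nV) × (∀ u w → Walk allEdges u w)

  Eulerian : Set
  Eulerian = Connected × (∀ v → 2 ∣ deg allEdges v)

  EulerianSub : EdgeSet → Set
  EulerianSub S = (∀ u w → Incident S u → Incident S w → Walk S u w)
                × (∀ v → 2 ∣ deg S v)

  isNeg : Fin nE → Bool
  isNeg e with σ e
  ... | Sign.- = true
  ... | Sign.+ = false

  negCount : EdgeSet → ℕ
  negCount S = ∑ (λ e → if S e ∧ isNeg e then 1 else 0)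

  -- Decomposition into three edge-disjoint eulerian subgraphs, each with an
  -- odd number of negative edges, sharing a common vertex.  The
  -- decomposition is given by a colouring of the edges with 3 colours.
  colourClass : (Fin nE → Fin 3) → Fin 3 → EdgeSet
  colourClass c i e = does (c e ≟ i)

  Decomposable : Set
  Decomposable = ∃ λ (c : Fin nE → Fin 3) → ∃ λ (v : Fin nV) →
    ∀ i → EulerianSub (colourClass c i)
        × ¬ (2 ∣ negCount (colourClass c i))
        × Incident (colourClass c i) v

  -- orientations: ω e b = true  iff half-edge b of e points toward its end
  Orientation : Set
  Orientation = Fin nE → Bool → Bool

  ValidOrientation : Orientation → Set
  ValidOrientation ω = ∀ e → ValidAt e (σ e)
    where
    ValidAt : Fin nE → Sign → Set
    ValidAt e Sign.+ = ω e false ≢ ω e true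
    ValidAt e Sign.- = ω e false ≡ ω e true

  outflow : Orientation → (Fin nE → ℤ) → Fin nV → ℤ
  outflow ω ξ v = ∑ℤ (λ e → half e false ℤ.+ half e true)
    where
    half : Fin nE → Bool → ℤ
    half e b = if does (end e b ≟ v)
               then (if ω e b then - ξ e else ξ e)
               else 0ℤ

  IsFlow : Orientation → (Fin nE → ℤ) → Set
  IsFlow ω ξ = ∀ v → outflow ω ξ v ≡ 0ℤ

  HasNZFlow : ℕ → Set
  HasNZFlow k = ∃ λ (ω : Orientation) → ValidOrientation ω ×
    ∃ λ (ξ : Fin nE → ℤ) → IsFlow ω ξ ×
      (∀ e → ξ e ≢ 0ℤ × ∣ ξ e ∣ < k)

  FlowNumberIs : ℕ → Set
  FlowNumberIs k = HasNZFlow k × (∀ j → j < k → ¬ HasNZFlow j)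

{-# OPTIONS --safe #-}
module Submission where

-- A trail that is consistently oriented behaves like a flow of value 1: it has
-- boundary only at its two ends, and a closed trail at v with an odd number of
-- negative edges has boundary ±2 at v.
--
-- Given three odd eulerian subgraphs through v, Euler tours from v yield such
-- functions f₀, f₁, f₂ with boundary 2 at v, and f₀ + f₁ - 2 f₂ is a 3-flow.
-- There is no 2-flow because the number of negative edges is odd.
--
-- Conversely, replace the values of a 3-flow by ±1 modulo 3: this orients G so
-- that all outflows are divisible by 3.  Cut an Euler tour of G into N
-- consistent trails and decrease N, keeping the divisibility.  A consistent
-- junction lets two trails be merged.  If two trails start at the same vertex
-- with opposite signs, reversing the block between them creates a consistent
-- junction.  Otherwise every vertex is the start of a multiple of 3 of the
-- trails.  Then N ≥ 3, and N = 3 gives three odd closed trails at one vertex.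
-- If N ≥ 4, Olson's theorem for (ℤ/3)ⁿ provides a nonempty proper set of trails
-- whose total boundary is divisible by 3; reversing the orientation on it keeps
-- the divisibility and creates a consistent junction.  If the process ends with
-- a single consistent closed trail, G has a 2-flow.

open import Data.Bool using (Bool; true; false; if_then_else_; not; _∧_)
import Data.Bool.Properties as 𝔹
open import Data.Fin using (Fin; zero; suc; _≟_; fromℕ<)
open import Data.Fin.Properties using (all?; any?; ¬∀⟶∃¬)
open import Data.Integer using (ℤ; 0ℤ; 1ℤ; +_; -[1+_]; _+_; _-_; _*_; -_; ∣_∣)
open import Data.Integer.Divisibility.Signed
open import Data.Integer.DivMod using (_%ℕ_; _/ℕ_; n%ℕd<d; a≡a%ℕn+[a/ℕn]*n)
import Data.Integer.Properties as ℤₚ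
open import Data.Integer.Tactic.RingSolver using (solve-∀)
open import Data.Nat as ℕ using (ℕ; zero; suc; z≤n; s≤s)
open import Data.Nat.Divisibility using (∣⇒≤) renaming (_∣_ to _∣ℕ_; _∣?_ to _∣ℕ?_)
import Data.Nat.Properties as ℕₚ
import Data.Nat.Tactic.RingSolver as ℕ-Solver
open import Data.Product using (∃; _×_; _,_; proj₁; proj₂)
open import Data.Sign as Sign using (Sign; opposite)
import Data.Sign.Properties as Signₚ
open import Data.Sum using (_⊎_; inj₁; inj₂)
open import Data.Unit using (⊤; tt)
open import Data.Vec using (Vec; []; _∷_; replicate)
open import Data.Vec.Properties using (≡-dec)
open import Defs
open import Function using (_∘_)
open import Function.Bundles using (_⇔_; mk⇔)
open import Relation.Binary.PropositionalEquality
open import Relation.Nullary using (¬_; Dec; yes; no; does; contradiction)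
open import Relation.Nullary.Decidable
  using (_×-dec_; _⊎-dec_; ¬?; map′; dec-true; dec-false; decidable-stable; toWitnessFalse)
open import Relation.Unary using (Decidable)

-- The polynomial method on the Boolean cube, and Olson's theorem modulo 3.

Δ : ∀ {m} → (Vec Bool (suc m) → ℤ) → Vec Bool m → ℤ
Δ F x = F (true ∷ x) - F (false ∷ x)

-- F agrees on the cube {0,1}^m with an integer polynomial of degree < k.
Deg< : ∀ m → ℕ → (Vec Bool m → ℤ) → Set
Deg< m       zero    F = ∀ x → F x ≡ 0ℤ
Deg< zero    (suc k) F = ⊤
Deg< (suc m) (suc k) F = Deg< m k (Δ F) × Deg< m (suc k) (F ∘ (false ∷_))

Deg<-cong : ∀ m k {F G} → (∀ x → F x ≡ G x) → Deg< m k F → Deg< m k G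
Deg<-cong m       zero    eq d       = λ x → trans (sym (eq x)) (d x)
Deg<-cong zero    (suc k) eq d       = tt
Deg<-cong (suc m) (suc k) eq (d , e) =
  Deg<-cong m k (λ x → cong₂ _-_ (eq _) (eq _)) d , Deg<-cong m (suc k) (λ x → eq _) e

Deg<-suc : ∀ m k {F} → Deg< m k F → Deg< m (suc k) F
Deg<-suc zero    k       d       = tt
Deg<-suc (suc m) zero    d       = (λ x → cong₂ _-_ (d _) (d _)) , Deg<-suc m zero (λ x → d _)
Deg<-suc (suc m) (suc k) (d , e) = Deg<-suc m k d , Deg<-suc m (suc k) e

Deg<-- : ∀ m k {F G} → Deg< m k F → Deg< m k G → Deg< m k (λ x → F x - G x)
Deg<-- m       zero    d d'              = λ x → cong₂ _-_ (d x) (d' x)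
Deg<-- zero    (suc k) d d'              = tt
Deg<-- (suc m) (suc k) {F} {G} (d , e) (d' , e') =
  Deg<-cong m k (λ x → lemma (F (true ∷ x)) (F (false ∷ x)) (G (true ∷ x)) (G (false ∷ x))) (Deg<-- m k d d')
  , Deg<-- m (suc k) e e'
  where
  lemma : ∀ a b c d → (a - b) - (c - d) ≡ (a - c) - (b - d)
  lemma = solve-∀

Deg<-* : ∀ m k {F} c → Deg< m k F → Deg< m k (λ x → c * F x)
Deg<-* m       zero    c d           = λ x → trans (cong (c *_) (d x)) (ℤₚ.*-zeroʳ c)
Deg<-* zero    (suc k) c d           = tt
Deg<-* (suc m) (suc k) {F} c (d , e) =
  Deg<-cong m k (λ x → lemma c (F (true ∷ x)) (F (false ∷ x))) (Deg<-* m k c d) , Deg<-* m (suc k) c e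
  where
  lemma : ∀ c a b → c * (a - b) ≡ c * a - c * b
  lemma = solve-∀

subsetSum : ∀ {m} → Vec ℤ m → Vec Bool m → ℤ
subsetSum []       []       = 0ℤ
subsetSum (a ∷ as) (b ∷ bs) = (if b then a else 0ℤ) + subsetSum as bs

-- Discrete Leibniz rule: the difference of the product is `Δ F` times the affine form shifted by
-- `a`, plus `a` times the restriction of F to `false`. The constant `c` is arbitrary so that the
-- induction can absorb `a` into it.
Deg<-affine : ∀ m k {F} c (as : Vec ℤ m) → Deg< m k F →
              Deg< m (suc k) (λ x → F x * (c + subsetSum as x))
Deg<-affine m       zero    c as       d = Deg<-suc m zero (λ x → cong (_* (c + subsetSum as x)) (d x))
Deg<-affine zero    (suc k) c as       d = tt
Deg<-affine (suc m) (suc k) {F} c (a ∷ as) (d , e) =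
  Deg<-cong m (suc k)
    (λ x → lemma (F (true ∷ x)) (F (false ∷ x)) c a (subsetSum as x))
    (Deg<-- m (suc k) (Deg<-affine m k (c + a) as d) (Deg<-* m (suc k) (- a) e))
  , Deg<-cong m (suc (suc k)) (λ x → cong (λ y → F (false ∷ x) * (c + y)) (sym (ℤₚ.+-identityˡ _)))
      (Deg<-affine m (suc k) c as e)
  where
  lemma : ∀ f₁ f₀ c a s → (f₁ - f₀) * ((c + a) + s) - (- a) * f₀
                        ≡ f₁ * (c + (a + s)) - f₀ * (c + (0ℤ + s))
  lemma = solve-∀

-- The coefficient of the product of all m variables in the multilinear polynomial that agrees with
-- F on the cube.
Δⁿ : ∀ m → (Vec Bool m → ℤ) → ℤ
Δⁿ zero    F = F []
Δⁿ (suc m) F = Δⁿ m (Δ F)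

Δⁿ-Deg< : ∀ m k {F} → k ℕ.≤ m → Deg< m k F → Δⁿ m F ≡ 0ℤ
Δⁿ-Deg< zero    zero    k≤m d = d []
Δⁿ-Deg< (suc m) zero    k≤m d = Δⁿ-Deg< m zero z≤n (λ x → cong₂ _-_ (d _) (d _))
Δⁿ-Deg< (suc m) (suc k) (s≤s k≤m) (d , _) = Δⁿ-Deg< m k k≤m d

∅ : ∀ m → Vec Bool m
∅ m = replicate m false

-- Up to sign `Δⁿ` is the alternating sum of F over the cube, and modulo p only the term at the
-- empty set survives.
Δⁿ-indicator : ∀ m (p : ℤ) {F} → (∀ x → x ≢ ∅ m → p ∣ F x) → ¬ (p ∣ F (∅ m)) → ¬ (p ∣ Δⁿ m F)
Δⁿ-indicator zero    p away at = at
Δⁿ-indicator (suc m) p {F} away at = Δⁿ-indicator m p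
  (λ x x≢∅ → ∣m∣n⇒∣m-n (away _ (λ ())) (away _ (λ eq → x≢∅ (tail≡ eq))))
  (λ p∣Δ → at (∣m∣n⇒∣m-n' (away (true ∷ ∅ m) (λ ())) p∣Δ))
  where
  tail≡ : ∀ {x : Vec Bool m} → _≡_ {A = Vec Bool (suc m)} (false ∷ x) (false ∷ ∅ m) → x ≡ ∅ m
  tail≡ refl = refl
  lemma : ∀ a b → a - (a - b) ≡ b
  lemma = solve-∀
  ∣m∣n⇒∣m-n' : ∀ {a b} → p ∣ a → p ∣ (a - b) → p ∣ b
  ∣m∣n⇒∣m-n' {a} {b} u v = subst (p ∣_) (lemma a b) (∣m∣n⇒∣m-n u v)

-- Fermat's little theorem for 3.
3∣1-s² : ∀ s → ¬ (+ 3 ∣ s) → + 3 ∣ (1ℤ - s * s)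
3∣1-s² s 3∤s with s %ℕ 3 | n%ℕd<d s 3 | a≡a%ℕn+[a/ℕn]*n s 3
... | 0 | _ | eq = contradiction (divides (s /ℕ 3) (trans eq (ℤₚ.+-identityˡ _))) 3∤s
... | 1 | _ | eq = divides (- (+ 2 * q + q * q * + 3)) (trans (cong (λ s → 1ℤ - s * s) eq) (lemma q))
  where
  q = s /ℕ 3
  lemma : ∀ q → 1ℤ - (1ℤ + q * + 3) * (1ℤ + q * + 3) ≡ - (+ 2 * q + q * q * + 3) * + 3
  lemma = solve-∀
... | 2 | _ | eq = divides (- (1ℤ + + 4 * q + q * q * + 3)) (trans (cong (λ s → 1ℤ - s * s) eq) (lemma q))
  where
  q = s /ℕ 3
  lemma : ∀ q → 1ℤ - (+ 2 + q * + 3) * (+ 2 + q * + 3) ≡ - (1ℤ + + 4 * q + q * q * + 3) * + 3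
  lemma = solve-∀
... | suc (suc (suc r)) | s≤s (s≤s (s≤s ())) | _

-- Exhaustive search, which lets a subset be extracted from the refutation of its absence in
-- `olson₃`.
any-subset? : ∀ m {P : Vec Bool m → Set} → Decidable P → Dec (∃ P)
any-subset? zero P? with P? []
... | yes p = yes ([] , p)
... | no ¬p = no λ { ([] , p) → ¬p p }
any-subset? (suc m) P? with any-subset? m (P? ∘ (true ∷_)) | any-subset? m (P? ∘ (false ∷_))
... | yes (x , p) | _           = yes (_ , p)
... | no _        | yes (x , p) = yes (_ , p)
... | no ¬p       | no ¬q       = no λ { (true ∷ x , p) → ¬p (x , p) ; (false ∷ x , p) → ¬q (x , p) }

-- The m vectors are stored by coordinates: `a v` lists their v-th entries. By Fermat the product
-- is, modulo 3, the indicator of the subsets whose sum vanishes in every coordinate.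
zeroIndicator : ∀ {m n} → (Fin n → Vec ℤ m) → Vec Bool m → ℤ
zeroIndicator {n = zero}  a x = 1ℤ
zeroIndicator {n = suc n} a x =
  zeroIndicator (a ∘ suc) x * (1ℤ - subsetSum (a zero) x * subsetSum (a zero) x)

subsetSum-∅ : ∀ {m} (as : Vec ℤ m) → subsetSum as (∅ m) ≡ 0ℤ
subsetSum-∅ []       = refl
subsetSum-∅ (a ∷ as) = trans (ℤₚ.+-identityˡ _) (subsetSum-∅ as)

zeroIndicator-∅ : ∀ {m n} (a : Fin n → Vec ℤ m) → zeroIndicator a (∅ m) ≡ 1ℤ
zeroIndicator-∅ {n = zero}  a = refl
zeroIndicator-∅ {n = suc n} a rewrite zeroIndicator-∅ (a ∘ suc) | subsetSum-∅ (a zero) = refl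

zeroIndicator-≢0 : ∀ {m n} (a : Fin n → Vec ℤ m) x v →
                   ¬ (+ 3 ∣ subsetSum (a v) x) → + 3 ∣ zeroIndicator a x
zeroIndicator-≢0 a x zero    ∤ = ∣n⇒∣m*n (zeroIndicator (a ∘ suc) x) (3∣1-s² _ ∤)
zeroIndicator-≢0 a x (suc v) ∤ = ∣m⇒∣m*n _ (zeroIndicator-≢0 (a ∘ suc) x v ∤)

-- The factor of an inactive coordinate is 1 and any other factor is quadratic, so the degree is
-- bounded by the number of active coordinates rather than by n.
zeroIndicator-Deg< : ∀ {m n} (a : Fin n → Vec ℤ m) (active : Fin n → Bool) →
  (∀ v → active v ≡ false → ∀ x → subsetSum (a v) x ≡ 0ℤ) →
  Deg< m (suc (∑ (λ v → if active v then 2 else 0))) (zeroIndicator a)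
zeroIndicator-Deg< {m} {zero}  a active inactive = one m
  where
  one : ∀ m → Deg< m 1 (λ _ → 1ℤ)
  one zero    = tt
  one (suc m) = (λ _ → refl) , one m
zeroIndicator-Deg< {m} {suc n} a active inactive
  with active zero in eq | zeroIndicator-Deg< (a ∘ suc) (active ∘ suc) (λ v → inactive (suc v))
... | false | d = Deg<-cong m _ (λ x → sym (lemma x)) d
  where
  lemma : ∀ x → zeroIndicator a x ≡ zeroIndicator (a ∘ suc) x
  lemma x rewrite inactive zero eq x = ℤₚ.*-identityʳ _
... | true  | d = Deg<-cong m _ (λ x → lemma (zeroIndicator (a ∘ suc) x) (subsetSum (a zero) x))
  (Deg<-- m _ (Deg<-suc m _ (Deg<-suc m _ d))
              (Deg<-affine m _ 0ℤ (a zero) (Deg<-affine m _ 0ℤ (a zero) d)))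
  where
  lemma : ∀ f s → f - f * (0ℤ + s) * (0ℤ + s) ≡ f * (1ℤ - s * s)
  lemma = solve-∀

-- Olson's theorem for (ℤ/3)ⁿ, by the Chevalley–Warning argument: if no such
-- subset existed, the indicator of the empty subset would have degree < m.
olson₃ : ∀ {m n} (a : Fin n → Vec ℤ m) (active : Fin n → Bool) →
  (∀ v → active v ≡ false → ∀ x → subsetSum (a v) x ≡ 0ℤ) →
  suc (∑ (λ v → if active v then 2 else 0)) ℕ.≤ m →
  ∃ λ x → x ≢ ∅ m × ∀ v → + 3 ∣ subsetSum (a v) x
olson₃ {m} {n} a active inactive few
  with any-subset? m (λ x → ¬? (≡-dec 𝔹._≟_ x (∅ m)) ×-dec all? (λ v → + 3 ∣? subsetSum (a v) x))
... | yes found = found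
... | no none = contradiction
  (subst (+ 3 ∣_) (sym (Δⁿ-Deg< m _ few (zeroIndicator-Deg< a active inactive))) (divides 0ℤ refl))
  (Δⁿ-indicator m (+ 3) away at)
  where
  away : ∀ x → x ≢ ∅ m → + 3 ∣ zeroIndicator a x
  away x x≢∅ with ¬∀⟶∃¬ n _ (λ v → + 3 ∣? subsetSum (a v) x) (λ all → none (x , x≢∅ , all))
  ... | v , ∤ = zeroIndicator-≢0 a x v ∤
  at : ¬ (+ 3 ∣ zeroIndicator a (∅ m))
  at 3∣ = contradiction (subst (+ 3 ∣_) (zeroIndicator-∅ a) 3∣) (toWitnessFalse {a? = + 3 ∣? 1ℤ} tt)

-- Finite sums, signs and residues.

bit : Bool → ℕ
bit b = if b then 1 else 0

δ : ∀ {n} → Fin n → Fin n → ℕ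
δ i j = bit (does (i ≟ j))

δ-refl : ∀ {n} (i : Fin n) → δ i i ≡ 1
δ-refl i = cong bit (dec-true (i ≟ i) refl)

δ-≢ : ∀ {n} {i j : Fin n} → i ≢ j → δ i j ≡ 0
δ-≢ {i = i} {j} i≢j = cong bit (dec-false (i ≟ j) i≢j)

∑ℤ-cong : ∀ {m} {f g : Fin m → ℤ} → (∀ i → f i ≡ g i) → ∑ℤ f ≡ ∑ℤ g
∑ℤ-cong {zero}  eq = refl
∑ℤ-cong {suc m} eq = cong₂ _+_ (eq zero) (∑ℤ-cong (eq ∘ suc))

∑ℤ-0 : ∀ m → ∑ℤ {m} (λ _ → 0ℤ) ≡ 0ℤ
∑ℤ-0 zero    = refl
∑ℤ-0 (suc m) = trans (ℤₚ.+-identityˡ _) (∑ℤ-0 m)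

∑ℤ-+ : ∀ {m} (f g : Fin m → ℤ) → ∑ℤ (λ i → f i + g i) ≡ ∑ℤ f + ∑ℤ g
∑ℤ-+ {zero}  f g = refl
∑ℤ-+ {suc m} f g = trans (cong (λ r → f zero + g zero + r) (∑ℤ-+ (f ∘ suc) (g ∘ suc))) (lemma (f zero) (g zero) _ _)
  where
  lemma : ∀ a b c d → (a + b) + (c + d) ≡ (a + c) + (b + d)
  lemma = solve-∀

∑ℤ-* : ∀ {m} c (f : Fin m → ℤ) → ∑ℤ (λ i → c * f i) ≡ c * ∑ℤ f
∑ℤ-* {zero}  c f = sym (ℤₚ.*-zeroʳ c)
∑ℤ-* {suc m} c f = trans (cong (λ r → c * f zero + r) (∑ℤ-* c (f ∘ suc))) (sym (ℤₚ.*-distribˡ-+ c _ _))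

∑ℤ-δ : ∀ {m} (j : Fin m) (F : Fin m → ℤ) → ∑ℤ (λ i → + δ j i * F i) ≡ F j
∑ℤ-δ {suc m} zero    F = trans (cong₂ _+_ (ℤₚ.*-identityˡ (F zero)) (∑ℤ-0 m)) (ℤₚ.+-identityʳ (F zero))
∑ℤ-δ {suc m} (suc j) F = trans (ℤₚ.+-identityˡ _) (∑ℤ-δ j (F ∘ suc))

∑ℤ-swap : ∀ {m n} (F : Fin m → Fin n → ℤ) → ∑ℤ (λ i → ∑ℤ (F i)) ≡ ∑ℤ (λ j → ∑ℤ (λ i → F i j))
∑ℤ-swap {zero}  {n} F = sym (∑ℤ-0 n)
∑ℤ-swap {suc m} {n} F = trans (cong (λ r → ∑ℤ (F zero) + r) (∑ℤ-swap (F ∘ suc))) (sym (∑ℤ-+ (F zero) _))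

+-∑ : ∀ {m} (f : Fin m → ℕ) → + ∑ f ≡ ∑ℤ (λ i → + f i)
+-∑ {zero}  f = refl
+-∑ {suc m} f = trans (ℤₚ.pos-+ (f zero) _) (cong (λ r → + f zero + r) (+-∑ (f ∘ suc)))

∑-mono : ∀ {m} {f g : Fin m → ℕ} → (∀ i → f i ℕ.≤ g i) → ∑ f ℕ.≤ ∑ g
∑-mono {zero}  le = z≤n
∑-mono {suc m} le = ℕₚ.+-mono-≤ (le zero) (∑-mono (le ∘ suc))

val : Sign → ℤ
val Sign.+ = 1ℤ
val Sign.- = - 1ℤ

val-* : ∀ s t → val (s Sign.* t) ≡ val s * val t
val-* Sign.+ Sign.+ = refl
val-* Sign.+ Sign.- = refl
val-* Sign.- Sign.+ = refl
val-* Sign.- Sign.- = refl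

val-opposite : ∀ s → val (opposite s) ≡ - val s
val-opposite Sign.+ = refl
val-opposite Sign.- = refl

val² : ∀ s → val s * val s ≡ 1ℤ
val² Sign.+ = refl
val² Sign.- = refl

*-opposite-* : ∀ s t → s Sign.* opposite (s Sign.* t) ≡ opposite t
*-opposite-* Sign.+ t      = refl
*-opposite-* Sign.- Sign.+ = refl
*-opposite-* Sign.- Sign.- = refl

≢⇒opposite : ∀ {s t : Sign} → s ≢ t → s ≡ opposite t
≢⇒opposite {Sign.+} {Sign.+} s≢t = contradiction refl s≢t
≢⇒opposite {Sign.+} {Sign.-} s≢t = refl
≢⇒opposite {Sign.-} {Sign.+} s≢t = refl
≢⇒opposite {Sign.-} {Sign.-} s≢t = contradiction refl s≢t

∑-+ : ∀ {m} (f g : Fin m → ℕ) → ∑ (λ i → f i ℕ.+ g i) ≡ ∑ f ℕ.+ ∑ g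
∑-+ {zero}  f g = refl
∑-+ {suc m} f g = trans (cong (f zero ℕ.+ g zero ℕ.+_) (∑-+ (f ∘ suc) (g ∘ suc))) (lemma (f zero) (g zero) _ _)
  where
  lemma : ∀ a b c d → (a ℕ.+ b) ℕ.+ (c ℕ.+ d) ≡ (a ℕ.+ c) ℕ.+ (b ℕ.+ d)
  lemma = ℕ-Solver.solve-∀

∑-0 : ∀ m → ∑ {m} (λ _ → 0) ≡ 0
∑-0 zero    = refl
∑-0 (suc m) = ∑-0 m

∑-δ : ∀ {m} (j : Fin m) → ∑ (δ j) ≡ 1
∑-δ {suc m} zero    = cong suc (∑-0 m)
∑-δ {suc m} (suc j) = ∑-δ j

∑-* : ∀ {m} c (f : Fin m → ℕ) → ∑ (λ i → c ℕ.* f i) ≡ c ℕ.* ∑ f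
∑-* {zero}  c f = sym (ℕₚ.*-zeroʳ c)
∑-* {suc m} c f = trans (cong (c ℕ.* f zero ℕ.+_) (∑-* c (f ∘ suc))) (sym (ℕₚ.*-distribˡ-+ c (f zero) _))

∑-cong : ∀ {m} {f g : Fin m → ℕ} → (∀ i → f i ≡ g i) → ∑ f ≡ ∑ g
∑-cong {zero}  eq = refl
∑-cong {suc m} eq = cong₂ ℕ._+_ (eq zero) (∑-cong (eq ∘ suc))

positive : ℕ → Bool
positive zero    = false
positive (suc n) = true

¬positive⇒0 : ∀ n → positive n ≡ false → n ≡ 0
¬positive⇒0 zero eq = refl

-- A positive multiple of 3 is at least 3. Summed over the vertices, this bounds the number of start
-- vertices by a third of the number of trails.
3∣⇒3*positive≤ : ∀ n → 3 ∣ℕ n → 3 ℕ.* bit (positive n) ℕ.≤ n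
3∣⇒3*positive≤ zero    3∣n = z≤n
3∣⇒3*positive≤ (suc n) 3∣n = ∣⇒≤ 3∣n

∑ℤ-∣ : ∀ {m} k (f : Fin m → ℤ) → (∀ i → k ∣ f i) → k ∣ ∑ℤ f
∑ℤ-∣ {zero}  k f k∣f = divides 0ℤ refl
∑ℤ-∣ {suc m} k f k∣f = ∣m∣n⇒∣m+n (k∣f zero) (∑ℤ-∣ k (f ∘ suc) (k∣f ∘ suc))

val≢0 : ∀ s → val s ≢ 0ℤ
val≢0 Sign.+ ()
val≢0 Sign.- ()

∣val∣ : ∀ s → ∣ val s ∣ ≡ 1
∣val∣ Sign.+ = refl
∣val∣ Sign.- = refl

-- Replacing each value of a 3-flow by its residue ±1 modulo 3 keeps the
-- outflow divisible by 3.
residue₃ : ∀ s {x} → x ≢ 0ℤ → ∣ x ∣ ℕ.< 3 → ∃ λ t → + 3 ∣ val t - x * val s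
residue₃ s      {+ 0}            x≢0 _ = contradiction refl x≢0
residue₃ Sign.+ {+ 1}            _ _ = Sign.+ , divides 0ℤ refl
residue₃ Sign.- {+ 1}            _ _ = Sign.- , divides 0ℤ refl
residue₃ Sign.+ {+ 2}            _ _ = Sign.- , divides (- 1ℤ) refl
residue₃ Sign.- {+ 2}            _ _ = Sign.+ , divides 1ℤ refl
residue₃ Sign.+ { -[1+ 0 ] }     _ _ = Sign.- , divides 0ℤ refl
residue₃ Sign.- { -[1+ 0 ] }     _ _ = Sign.+ , divides 0ℤ refl
residue₃ Sign.+ { -[1+ 1 ] }     _ _ = Sign.+ , divides 1ℤ refl
residue₃ Sign.- { -[1+ 1 ] }     _ _ = Sign.- , divides (- 1ℤ) refl
residue₃ s {+ suc (suc (suc _))} _ (s≤s (s≤s (s≤s ())))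
residue₃ s { -[1+ suc (suc _) ]} _ (s≤s (s≤s (s≤s ())))

unit : ∀ {x} → x ≢ 0ℤ → ∣ x ∣ ℕ.< 2 → ∃ λ s → x ≡ val s
unit {+ 0}             x≢0 _ = contradiction refl x≢0
unit {+ 1}             _   _ = Sign.+ , refl
unit { -[1+ 0 ] }      _   _ = Sign.- , refl
unit {+ suc (suc _)}   _   (s≤s (s≤s ()))
unit { -[1+ suc _ ] }  _   (s≤s (s≤s ()))

ends-differ : ∀ {a b} → a ≢ b → (if b then Sign.- else Sign.+) ≡ opposite (if a then Sign.- else Sign.+)
ends-differ {true}  {true}  a≢b = contradiction refl a≢b
ends-differ {true}  {false} a≢b = refl
ends-differ {false} {true}  a≢b = refl
ends-differ {false} {false} a≢b = contradiction refl a≢b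

module _ (G : SignedGraph) where
  open SignedGraph G

  -- Trails and Euler tours

  Dart : Set
  Dart = Fin nE × Bool

  tail head : Dart → Fin nV
  tail (e , b) = end e b
  head (e , b) = end e (not b)

  infixr 5 _∷_ _++_

  -- Repeated edges are not excluded by the type; they are controlled by conditions on `occ`.
  data Trail : Fin nV → Fin nV → Set where
    []  : ∀ {x} → Trail x x
    _∷_ : ∀ d {y} → Trail (head d) y → Trail (tail d) y

  _++_ : ∀ {x y z} → Trail x y → Trail y z → Trail x z
  []      ++ w' = w'
  (d ∷ w) ++ w' = d ∷ (w ++ w')

  occ : ∀ {x y} → Trail x y → Fin nE → ℕ
  occ []            e = 0
  occ ((e' , _) ∷ w) e = δ e' e ℕ.+ occ w e

  occ-++ : ∀ {x y z} (w : Trail x y) (w' : Trail y z) e → occ (w ++ w') e ≡ occ w e ℕ.+ occ w' e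
  occ-++ []      w' e = refl
  occ-++ ((e' , _) ∷ w) w' e = trans (cong (δ e' e ℕ.+_) (occ-++ w w' e)) (sym (ℕₚ.+-assoc (δ e' e) _ _))

  ∑trail : ∀ {x y} → (Fin nE → ℤ) → Trail x y → ℤ
  ∑trail F []            = 0ℤ
  ∑trail F ((e , _) ∷ w) = F e + ∑trail F w

  ∑-occ : ∀ {x y} (F : Fin nE → ℤ) (w : Trail x y) → ∑ℤ (λ e → + occ w e * F e) ≡ ∑trail F w
  ∑-occ F []            = ∑ℤ-0 nE
  ∑-occ F ((e' , _) ∷ w) = trans
    (∑ℤ-cong (λ e → trans (cong (_* F e) (ℤₚ.pos-+ (δ e' e) _)) (ℤₚ.*-distribʳ-+ (F e) (+ δ e' e) (+ occ w e))))
    (trans (∑ℤ-+ (λ e → + δ e' e * F e) (λ e → + occ w e * F e)) (cong₂ _+_ (∑ℤ-δ e' F) (∑-occ F w)))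

  ∑on : EdgeSet G → (Fin nE → ℤ) → ℤ
  ∑on S F = ∑ℤ (λ e → + bit (S e) * F e)

  ∑on-split : ∀ {x y S R} (w : Trail x y) → (∀ e → occ w e ℕ.+ bit (R e) ≡ bit (S e)) →
              ∀ F → ∑on S F ≡ ∑trail F w + ∑on R F
  ∑on-split {S = S} {R} w eq F = trans
    (∑ℤ-cong (λ e → trans (cong (λ n → + n * F e) (sym (eq e)))
      (trans (cong (_* F e) (ℤₚ.pos-+ (occ w e) _)) (ℤₚ.*-distribʳ-+ (F e) (+ occ w e) (+ bit (R e))))))
    (trans (∑ℤ-+ (λ e → + occ w e * F e) (λ e → + bit (R e) * F e)) (cong (_+ ∑on R F) (∑-occ F w)))

  ends : Fin nV → Fin nE → ℤ
  ends v e = + endsAt G e v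

  ends-dart : ∀ v e b → ends v e ≡ + δ (end e b) v + + δ (end e (not b)) v
  ends-dart v e false = ℤₚ.pos-+ (δ (end e false) v) _
  ends-dart v e true  = trans (ℤₚ.pos-+ (δ (end e false) v) _) (ℤₚ.+-comm (+ δ (end e false) v) (+ δ (end e true) v))

  deg-∑on : ∀ S v → + deg G S v ≡ ∑on S (ends v)
  deg-∑on S v = trans (+-∑ (λ e → if S e then endsAt G e v else 0)) (∑ℤ-cong lemma)
    where
    lemma : ∀ e → + (if S e then endsAt G e v else 0) ≡ + bit (S e) * ends v e
    lemma e with S e
    ... | true  = sym (ℤₚ.*-identityˡ _)
    ... | false = refl

  -- Every inner visit to a vertex uses two edge ends, so only the end vertices can have odd counts,
  -- and they cancel when they coincide.
  ∑trail-ends : ∀ v {x y} (w : Trail x y) → + 2 ∣ (∑trail (ends v) w + + δ x v) + + δ y v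
  ∑trail-ends v {x} [] = divides (+ δ x v) (lemma (+ δ x v))
    where
    lemma : ∀ a → (0ℤ + a) + a ≡ a * + 2
    lemma = solve-∀
  ∑trail-ends v {y = y} ((e , b) ∷ w) = subst (+ 2 ∣_) (sym eq)
    (∣m∣n⇒∣m+n (∑trail-ends v w) (divides (+ δ (end e b) v) refl))
    where
    lemma : ∀ t h s y → ((t + h + s) + t) + y ≡ ((s + h) + y) + t * + 2
    lemma = solve-∀
    eq : ((ends v e + ∑trail (ends v) w) + + δ (end e b) v) + + δ y v
       ≡ ((∑trail (ends v) w + + δ (end e (not b)) v) + + δ y v) + + δ (end e b) v * + 2
    eq rewrite ends-dart v e b = lemma (+ δ (end e b) v) (+ δ (end e (not b)) v) (∑trail (ends v) w) (+ δ y v)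

  size : EdgeSet G → ℕ
  size S = ∑ (bit ∘ S)

  infixl 6 _∖_
  _∖_ : EdgeSet G → Fin nE → EdgeSet G
  (S ∖ e) e' = S e' ∧ not (does (e ≟ e'))

  bit-∖ : ∀ {S e} → S e ≡ true → ∀ e' → δ e e' ℕ.+ bit ((S ∖ e) e') ≡ bit (S e')
  bit-∖ {S} {e} Se e' with e ≟ e'
  ... | yes refl rewrite Se = refl
  ... | no _ = cong bit (𝔹.∧-identityʳ (S e'))

  ∑on-∖ : ∀ {S e} → S e ≡ true → ∀ F → ∑on S F ≡ F e + ∑on (S ∖ e) F
  ∑on-∖ {S} {e} Se F = trans
    (∑on-split {S = S} {S ∖ e} ((e , true) ∷ []) (λ e' → trans (cong (ℕ._+ bit ((S ∖ e) e')) (ℕₚ.+-identityʳ (δ e e'))) (bit-∖ {S} {e} Se e')) F)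
    (cong (_+ ∑on (S ∖ e) F) (ℤₚ.+-identityʳ (F e)))

  size-∑on : ∀ S → + size S ≡ ∑on S (λ _ → 1ℤ)
  size-∑on S = trans (+-∑ (λ e → bit (S e))) (∑ℤ-cong {nE} (λ e → sym (ℤₚ.*-identityʳ (+ bit (S e)))))

  size-∖ : ∀ {S e} → S e ≡ true → size S ≡ suc (size (S ∖ e))
  size-∖ {S} {e} Se = ℤₚ.+-injective (trans (size-∑on S)
    (trans (∑on-∖ {S} {e} Se (λ _ → 1ℤ)) (cong (λ n → 1ℤ + n) (sym (size-∑on (S ∖ e))))))

  incident? : ∀ S v → Dec (Incident G S v)
  incident? S v = any? λ e → (S e 𝔹.≟ true) ×-dec map′
    (λ { (inj₁ eq) → false , eq ; (inj₂ eq) → true , eq })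
    (λ { (false , eq) → inj₁ eq ; (true , eq) → inj₂ eq })
    ((end e false ≟ v) ⊎-dec (end e true ≟ v))

  ∑on-¬incident : ∀ S v → ¬ Incident G S v → ∑on S (ends v) ≡ 0ℤ
  ∑on-¬incident S v ¬inc = trans (∑ℤ-cong lemma) (∑ℤ-0 nE)
    where
    lemma : ∀ e → + bit (S e) * ends v e ≡ 0ℤ
    lemma e with S e in eq
    ... | false = refl
    ... | true
      rewrite δ-≢ (λ eq' → ¬inc (e , eq , false , eq'))
            | δ-≢ (λ eq' → ¬inc (e , eq , true , eq')) = refl

  -- Degrees in R are odd exactly at x and y if these differ; if x and y coincide, the two
  -- corrections cancel modulo 2 and all degrees are even.
  EvenExcept : EdgeSet G → Fin nV → Fin nV → Set
  EvenExcept R x y = ∀ v → + 2 ∣ (∑on R (ends v) + + δ x v) + + δ y v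

  -- Deleting an edge changes the parity at both of its ends, which moves the exceptional vertex
  -- along the edge.
  EvenExcept-∖ : ∀ {R e} b {y} → R e ≡ true → EvenExcept R (end e b) y → EvenExcept (R ∖ e) (end e (not b)) y
  EvenExcept-∖ {R} {e} b {y} Re even v = subst (+ 2 ∣_) eq
    (∣m∣n⇒∣m-n (even v) (divides (+ δ (end e b) v) refl))
    where
    lemma : ∀ t h s y → (((t + h + s) + t) + y) - t * + 2 ≡ (s + h) + y
    lemma = solve-∀
    eq : ((∑on R (ends v) + + δ (end e b) v) + + δ y v) - + δ (end e b) v * + 2
       ≡ (∑on (R ∖ e) (ends v) + + δ (end e (not b)) v) + + δ y v
    eq rewrite ∑on-∖ {R} {e} Re (ends v) | ends-dart v e b =
      lemma (+ δ (end e b) v) (+ δ (end e (not b)) v) (∑on (R ∖ e) (ends v)) (+ δ y v)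

  -- A greedy walk cannot get stuck before y: at any other current vertex the number of remaining
  -- edge ends is odd, hence not zero. The bound n on the remaining edges makes it terminate.
  walkToEnd : ∀ n R x y → size R ℕ.≤ n → EvenExcept R x y →
              ∃ λ (w : Trail x y) → ∃ λ (R' : EdgeSet G) → ∀ e → occ w e ℕ.+ bit (R' e) ≡ bit (R e)
  walkToEnd n R x y R≤n even with x ≟ y
  ... | yes refl = [] , R , λ e → refl
  ... | no x≢y with incident? R x
  ...   | no ¬inc = contradiction (subst (+ 2 ∣_) eq (even x)) (toWitnessFalse {a? = + 2 ∣? 1ℤ} tt)
    where
    eq : (∑on R (ends x) + + δ x x) + + δ y x ≡ 1ℤ
    eq rewrite ∑on-¬incident R x ¬inc | δ-refl x | δ-≢ (x≢y ∘ sym) = refl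
  walkToEnd zero    R x y R≤n even | no _ | yes (e , Re , b , refl)
    with subst (ℕ._≤ 0) (size-∖ {R} {e} Re) R≤n
  ... | ()
  walkToEnd (suc n) R x y R≤n even | no _ | yes (e , Re , b , refl)
    with walkToEnd n (R ∖ e) (end e (not b)) y
           (ℕₚ.≤-pred (subst (ℕ._≤ suc n) (size-∖ {R} {e} Re) R≤n)) (EvenExcept-∖ {R} {e} b {y} Re even)
  ... | w , R' , split = (e , b) ∷ w , R' , λ e' →
    trans (ℕₚ.+-assoc (δ e e') _ _) (trans (cong (δ e e' ℕ.+_) (split e')) (bit-∖ {R} {e} Re e'))

  -- A visit of the trail to x, recorded as a place to cut it. Only the edge counts of the two
  -- pieces matter for splicing.
  Through : Fin nV → ∀ {y z} → Trail y z → Set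
  Through x {y} {z} w = ∃ λ (w₁ : Trail y x) → ∃ λ (w₂ : Trail x z) → ∀ e → occ w₁ e ℕ.+ occ w₂ e ≡ occ w e

  through-end : ∀ e b {y z} (w : Trail y z) → occ w e ≢ 0 → Through (end e b) w
  through-end e b [] occ≢0 = contradiction refl occ≢0
  through-end e b ((e' , b') ∷ w) occ≢0 with e' ≟ e
  through-end e false ((e , false) ∷ w) _ | yes refl = [] , (e , false) ∷ w , λ _ → refl
  through-end e true  ((e , true)  ∷ w) _ | yes refl = [] , (e , true) ∷ w , λ _ → refl
  through-end e false ((e , true)  ∷ w) _ | yes refl = (e , true) ∷ [] , w , λ e' → cong (ℕ._+ occ w e') (ℕₚ.+-identityʳ (δ e e'))
  through-end e true  ((e , false) ∷ w) _ | yes refl = (e , false) ∷ [] , w , λ e' → cong (ℕ._+ occ w e') (ℕₚ.+-identityʳ (δ e e'))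
  through-end e b ((e' , b') ∷ w) occ≢0 | no _ with through-end e b w occ≢0
  ... | w₁ , w₂ , eq = (e' , b') ∷ w₁ , w₂ , λ e'' →
    trans (ℕₚ.+-assoc (δ e' e'') _ _) (cong (δ e' e'' ℕ.+_) (eq e''))

  unused-edge-on-trail : ∀ {S R u t y z} (w : Trail y z) → (∀ e → occ w e ℕ.+ bit (R e) ≡ bit (S e)) →
    Walk G S u t → Through u w → Incident G R t → ∃ λ e → ∃ λ b → R e ≡ true × Through (end e b) w
  unused-edge-on-trail w eq (here _) thr (e , Re , b , refl) = e , b , Re , thr
  unused-edge-on-trail {R = R} w eq (step e b Se walk) thr inc with R e in Re
  ... | true  = e , b , Re , thr
  ... | false = unused-edge-on-trail w eq walk (through-end e (not b) w occ≢0) inc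
    where
    occ≢0 : occ w e ≢ 0
    occ≢0 occ≡0 with trans (sym (cong₂ ℕ._+_ occ≡0 (cong bit Re))) (trans (eq e) (cong bit Se))
    ... | ()

  euler-tour : ∀ S v → (∀ e → S e ≡ true → Walk G S v (end e false)) → (∀ u → 2 ∣ℕ deg G S u) →
               ∃ λ (w : Trail v v) → ∀ e → occ w e ≡ bit (S e)
  euler-tour S v conn even = grow (size S) S [] ℕₚ.≤-refl (λ e → refl)
    where
    grow : ∀ n R (w : Trail v v) → size R ℕ.≤ n → (∀ e → occ w e ℕ.+ bit (R e) ≡ bit (S e)) →
           ∃ λ (w : Trail v v) → ∀ e → occ w e ≡ bit (S e)
    grow n R w R≤n eq with any? (λ e → R e 𝔹.≟ true)
    ... | no ¬R = w , λ e → trans (sym (trans (cong (λ b → occ w e ℕ.+ bit b) (𝔹.¬-not (λ Re → ¬R (e , Re)))) (ℕₚ.+-identityʳ _))) (eq e)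
    ... | yes (e₀ , Re₀)
      with unused-edge-on-trail w eq
             (conn e₀ (S-true e₀ Re₀))
             ([] , w , λ _ → refl) (e₀ , Re₀ , false , refl)
      where
      S-true : ∀ e → R e ≡ true → S e ≡ true
      S-true e Re with S e in Se
      ... | true = refl
      ... | false with ℕₚ.m+n≡0⇒n≡0 (occ w e) (trans (eq e) (cong bit Se))
      ...   | b≡0 rewrite Re with b≡0
      ...     | ()
    grow zero R w R≤n eq | yes _ | e , b , Re , _ with subst (ℕ._≤ 0) (size-∖ {R} {e} Re) R≤n
    ... | ()
    grow (suc n) R w R≤n eq | yes _ | e , b , Re , w₁ , w₂ , split
      with walkToEnd n (R ∖ e) (end e (not b)) (end e b) R∖e≤n (EvenExcept-∖ {R} {e} b {end e b} Re R-even)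
      where
      R∖e≤n : size (R ∖ e) ℕ.≤ n
      R∖e≤n = ℕₚ.≤-pred (subst (ℕ._≤ suc n) (size-∖ {R} {e} Re) R≤n)
      lemma : ∀ s w v x → (s - ((w + v) + v)) + (v + x) * + 2 ≡ (((s - w) + x) + x)
      lemma = solve-∀
      lemma' : ∀ w r → (w + r) - w ≡ r
      lemma' = solve-∀
      R-even : EvenExcept R (end e b) (end e b)
      R-even u = subst (+ 2 ∣_)
        (trans (lemma (∑on S (ends u)) (∑trail (ends u) w) (+ δ v u) (+ δ (end e b) u))
          (cong (λ r → (r + + δ (end e b) u) + + δ (end e b) u)
            (trans (cong (_- ∑trail (ends u) w) (∑on-split {S = S} {R} w eq (ends u))) (lemma' (∑trail (ends u) w) _))))
        (∣m∣n⇒∣m+n (∣m∣n⇒∣m-n (subst (+ 2 ∣_) (deg-∑on S u) (∣ᵤ⇒∣ (even u))) (∑trail-ends u w))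
                   (divides (+ δ v u + + δ (end e b) u) refl))
    ... | w' , R' , eq' = grow n R' (w₁ ++ (e , b) ∷ w' ++ w₂)
      (ℕₚ.≤-trans (∑-mono (λ e' → ℕₚ.≤-trans (ℕₚ.m≤n+m _ (occ w' e')) (ℕₚ.≤-reflexive (eq' e'))))
        (ℕₚ.≤-pred (subst (ℕ._≤ suc n) (size-∖ {R} {e} Re) R≤n)))
      new-eq
      where
      lemma : ∀ a d w b r → a ℕ.+ (d ℕ.+ (w ℕ.+ b)) ℕ.+ r ≡ (a ℕ.+ b) ℕ.+ (d ℕ.+ (w ℕ.+ r))
      lemma = ℕ-Solver.solve-∀
      new-eq : ∀ e' → occ (w₁ ++ (e , b) ∷ w' ++ w₂) e' ℕ.+ bit (R' e') ≡ bit (S e')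
      new-eq e' = begin
        occ (w₁ ++ (e , b) ∷ w' ++ w₂) e' ℕ.+ bit (R' e')
          ≡⟨ cong (ℕ._+ bit (R' e')) (trans (occ-++ w₁ _ e') (cong (λ k → occ w₁ e' ℕ.+ (δ e e' ℕ.+ k)) (occ-++ w' w₂ e'))) ⟩
        occ w₁ e' ℕ.+ (δ e e' ℕ.+ (occ w' e' ℕ.+ occ w₂ e')) ℕ.+ bit (R' e')
          ≡⟨ lemma (occ w₁ e') (δ e e') (occ w' e') (occ w₂ e') (bit (R' e')) ⟩
        (occ w₁ e' ℕ.+ occ w₂ e') ℕ.+ (δ e e' ℕ.+ (occ w' e' ℕ.+ bit (R' e')))
          ≡⟨ cong₂ ℕ._+_ (split e') (trans (cong (δ e e' ℕ.+_) (eq' e')) (bit-∖ {R} {e} Re e')) ⟩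
        occ w e' ℕ.+ bit (R e')
          ≡⟨ eq e' ⟩
        bit (S e') ∎
        where open ≡-Reasoning

  -- Tours of consistently oriented trails

  sgn : ∀ {x y} → Trail x y → Sign
  sgn []            = Sign.+
  sgn ((e , _) ∷ w) = σ e Sign.* sgn w

  sgn-++ : ∀ {x y z} (w : Trail x y) (w' : Trail y z) → sgn (w ++ w') ≡ sgn w Sign.* sgn w'
  sgn-++ []            w' = refl
  sgn-++ ((e , _) ∷ w) w' = trans (cong (σ e Sign.*_) (sgn-++ w w')) (sym (Signₚ.*-assoc (σ e) (sgn w) (sgn w')))

  reverse : ∀ {x y} → Trail x y → Trail y x
  reverse []                = []
  reverse ((e , true)  ∷ w) = _++_ (reverse w) ((e , false) ∷ [])
  reverse ((e , false) ∷ w) = _++_ (reverse w) ((e , true) ∷ [])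

  occ-reverse : ∀ {x y} (w : Trail x y) e → occ (reverse w) e ≡ occ w e
  occ-reverse []                e = refl
  occ-reverse ((e' , true)  ∷ w) e = trans (occ-++ (reverse w) _ e)
    (trans (cong₂ ℕ._+_ (occ-reverse w e) (ℕₚ.+-identityʳ (δ e' e))) (ℕₚ.+-comm (occ w e) (δ e' e)))
  occ-reverse ((e' , false) ∷ w) e = trans (occ-++ (reverse w) _ e)
    (trans (cong₂ ℕ._+_ (occ-reverse w e) (ℕₚ.+-identityʳ (δ e' e))) (ℕₚ.+-comm (occ w e) (δ e' e)))

  sgn-reverse : ∀ {x y} (w : Trail x y) → sgn (reverse w) ≡ sgn w
  sgn-reverse []                = refl
  sgn-reverse ((e , true)  ∷ w) = trans (sgn-++ (reverse w) _)
    (trans (cong₂ Sign._*_ (sgn-reverse w) (Signₚ.*-identityʳ (σ e))) (Signₚ.*-comm (sgn w) (σ e)))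
  sgn-reverse ((e , false) ∷ w) = trans (sgn-++ (reverse w) _)
    (trans (cong₂ Sign._*_ (sgn-reverse w) (Signₚ.*-identityʳ (σ e))) (Signₚ.*-comm (sgn w) (σ e)))

  -- Along a consistently oriented trail the contributions at inner visits cancel, which leaves the
  -- two terminal half-edges.
  boundary : ∀ {x y} → Trail x y → Sign → Fin nV → ℤ
  boundary {x} {y} w t v = val t * + δ x v - val (sgn w Sign.* t) * + δ y v

  -- A segment ⟨ w , t ⟩ is the trail w oriented consistently, a half-edge
  -- counting + if it is directed out of its vertex: w leaves its first vertex
  -- with sign t and enters its last vertex with the opposite of sgn w * t.
  infixr 5 ⟨_,_⟩∷_

  data Tour : Fin nV → Fin nV → Set where
    []      : ∀ {x} → Tour x x
    ⟨_,_⟩∷_ : ∀ {x y z} → Trail x y → Sign → Tour y z → Tour x z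

  length : ∀ {x y} → Tour x y → ℕ
  length []              = 0
  length (⟨ _ , _ ⟩∷ T) = suc (length T)

  occᵀ : ∀ {x y} → Tour x y → Fin nE → ℕ
  occᵀ []              e = 0
  occᵀ (⟨ w , _ ⟩∷ T) e = occ w e ℕ.+ occᵀ T e

  boundaryᵀ : ∀ {x y} → Tour x y → Fin nV → ℤ
  boundaryᵀ []              v = 0ℤ
  boundaryᵀ (⟨ w , t ⟩∷ T) v = boundary w t v + boundaryᵀ T v

  infixr 5 _++ᵀ_

  _++ᵀ_ : ∀ {x y z} → Tour x y → Tour y z → Tour x z
  []              ++ᵀ T' = T'
  (⟨ w , t ⟩∷ T) ++ᵀ T' = ⟨ w , t ⟩∷ (T ++ᵀ T')

  length-++ᵀ : ∀ {x y z} (T : Tour x y) (T' : Tour y z) → length (T ++ᵀ T') ≡ length T ℕ.+ length T'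
  length-++ᵀ []              T' = refl
  length-++ᵀ (⟨ _ , _ ⟩∷ T) T' = cong suc (length-++ᵀ T T')

  occᵀ-++ᵀ : ∀ {x y z} (T : Tour x y) (T' : Tour y z) e → occᵀ (T ++ᵀ T') e ≡ occᵀ T e ℕ.+ occᵀ T' e
  occᵀ-++ᵀ []              T' e = refl
  occᵀ-++ᵀ (⟨ w , _ ⟩∷ T) T' e =
    trans (cong (occ w e ℕ.+_) (occᵀ-++ᵀ T T' e)) (sym (ℕₚ.+-assoc (occ w e) _ _))

  boundaryᵀ-++ᵀ : ∀ {x y z} (T : Tour x y) (T' : Tour y z) v →
                  boundaryᵀ (T ++ᵀ T') v ≡ boundaryᵀ T v + boundaryᵀ T' v
  boundaryᵀ-++ᵀ []              T' v = sym (ℤₚ.+-identityˡ (boundaryᵀ T' v))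
  boundaryᵀ-++ᵀ (⟨ w , t ⟩∷ T) T' v =
    trans (cong (λ r → boundary w t v + r) (boundaryᵀ-++ᵀ T T' v))
          (sym (ℤₚ.+-assoc (boundary w t v) (boundaryᵀ T v) (boundaryᵀ T' v)))

  -- The sign with which a further trail must leave the end of the tour for a consistent junction;
  -- `s` is this sign for the empty tour.
  endSign : Sign → ∀ {x y} → Tour x y → Sign
  endSign s []              = s
  endSign s (⟨ w , t ⟩∷ T) = endSign (sgn w Sign.* t) T

  boundary-++ : ∀ {x y z} (w : Trail x y) (w' : Trail y z) t v →
    boundary (w ++ w') t v ≡ boundary w t v + boundary w' (sgn w Sign.* t) v
  boundary-++ {x} {y} {z} w w' t v
    rewrite sgn-++ w w' | Signₚ.*-comm (sgn w) (sgn w') | Signₚ.*-assoc (sgn w') (sgn w) t =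
    lemma (val t * + δ x v) (val (sgn w Sign.* t) * + δ y v) (val (sgn w' Sign.* (sgn w Sign.* t)) * + δ z v)
    where
    lemma : ∀ a b c → a - c ≡ (a - b) + (b - c)
    lemma = solve-∀

  -- One step of the descent. The boundary is kept exactly, so divisibility by 3 survives together
  -- with the covering of the edges.
  record Shorter {x y} (T : Tour x y) : Set where
    constructor shorter
    field
      tour       : Tour x y
      length-eq  : suc (length tour) ≡ length T
      occ-eq     : ∀ e → occᵀ tour e ≡ occᵀ T e
      bd-eq      : ∀ v → boundaryᵀ tour v ≡ boundaryᵀ T v

  merge : ∀ {x y z u} (w : Trail x y) t (w' : Trail y z) t' (T : Tour z u) →
          t' ≡ sgn w Sign.* t → Shorter (⟨ w , t ⟩∷ ⟨ w' , t' ⟩∷ T)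
  merge w t w' _ T refl = shorter (⟨ w ++ w' , t ⟩∷ T) refl
    (λ e → trans (cong (ℕ._+ occᵀ T e) (occ-++ w w' e)) (ℕₚ.+-assoc (occ w e) _ _))
    (λ v → trans (cong (_+ boundaryᵀ T v) (boundary-++ w w' t v))
                 (ℤₚ.+-assoc (boundary w t v) (boundary w' (sgn w Sign.* t) v) (boundaryᵀ T v)))

  keep : ∀ {x y z} (w : Trail x y) t {T : Tour y z} → Shorter T → Shorter (⟨ w , t ⟩∷ T)
  keep w t (shorter T' l o b) = shorter (⟨ w , t ⟩∷ T') (cong suc l)
    (λ e → cong (occ w e ℕ.+_) (o e)) (λ v → cong (λ r → boundary w t v + r) (b v))

  -- A junction is bad if the two half-edges meeting there have equal signs.
  BadAfter : Sign → ∀ {x y} → Tour x y → Set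
  BadAfter s []              = ⊤
  BadAfter s (⟨ w , t ⟩∷ T) = t ≡ opposite s × BadAfter (sgn w Sign.* t) T

  merge-junction : ∀ {x y z} (w : Trail x y) t (T : Tour y z) →
                   Shorter (⟨ w , t ⟩∷ T) ⊎ BadAfter (sgn w Sign.* t) T
  merge-junction w t [] = inj₂ tt
  merge-junction w t (⟨ w' , t' ⟩∷ T) with t' Signₚ.≟ sgn w Sign.* t
  ... | yes good = inj₁ (merge w t w' t' T good)
  ... | no bad with merge-junction w' t' T
  ...   | inj₁ s    = inj₁ (keep w t s)
  ...   | inj₂ bads = inj₂ (≢⇒opposite bad , bads)

  -- Uncrossing trails that start at one vertex with opposite signs.

  extend : ∀ {x y z u} → Trail x y → Sign → Tour y z → Trail z u → Tour x u
  extend w t []                w' = ⟨ w ++ w' , t ⟩∷ []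
  extend w t (⟨ w₁ , t₁ ⟩∷ T) w' = ⟨ w , t ⟩∷ extend w₁ t₁ T w'

  length-extend : ∀ {x y z u} (w : Trail x y) t (T : Tour y z) (w' : Trail z u) →
                  length (extend w t T w') ≡ suc (length T)
  length-extend w t []                w' = refl
  length-extend w t (⟨ w₁ , t₁ ⟩∷ T) w' = cong suc (length-extend w₁ t₁ T w')

  occ-extend : ∀ {x y z u} (w : Trail x y) t (T : Tour y z) (w' : Trail z u) e →
               occᵀ (extend w t T w') e ≡ (occ w e ℕ.+ occᵀ T e) ℕ.+ occ w' e
  occ-extend w t [] w' e = trans (ℕₚ.+-identityʳ _)
    (trans (occ-++ w w' e) (cong (ℕ._+ occ w' e) (sym (ℕₚ.+-identityʳ (occ w e)))))
  occ-extend w t (⟨ w₁ , t₁ ⟩∷ T) w' e =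
    trans (cong (occ w e ℕ.+_) (occ-extend w₁ t₁ T w' e)) (sym (ℕₚ.+-assoc (occ w e) _ _))

  boundary-extend : ∀ {x y z u} (w : Trail x y) t (T : Tour y z) (w' : Trail z u) t' →
    t' ≡ endSign t (⟨ w , t ⟩∷ T) → ∀ v →
    boundaryᵀ (extend w t T w') v ≡ (boundary w t v + boundaryᵀ T v) + boundary w' t' v
  boundary-extend w t [] w' _ refl v = trans (ℤₚ.+-identityʳ (boundary (w ++ w') t v))
    (trans (boundary-++ w w' t v) (cong (_+ boundary w' (sgn w Sign.* t) v) (sym (ℤₚ.+-identityʳ (boundary w t v)))))
  boundary-extend w t (⟨ w₁ , t₁ ⟩∷ T) w' t' eq v =
    trans (cong (λ r → boundary w t v + r) (boundary-extend w₁ t₁ T w' t' eq v))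
          (sym (ℤₚ.+-assoc (boundary w t v) (boundaryᵀ (⟨ w₁ , t₁ ⟩∷ T) v) (boundary w' t' v)))

  -- Only the direction of traversal changes, not the orientation: read backwards, the trail leaves
  -- with the sign of its former last half-edge.
  boundary-reverse : ∀ {x y} (w : Trail x y) t v →
    boundary (reverse w) (opposite (sgn w Sign.* t)) v ≡ boundary w t v
  boundary-reverse {x} {y} w t v rewrite sgn-reverse w | *-opposite-* (sgn w) t
    | val-opposite (sgn w Sign.* t) | val-opposite t =
    lemma (val t) (val (sgn w Sign.* t)) (+ δ x v) (+ δ y v)
    where
    lemma : ∀ t s a b → - s * b - - t * a ≡ t * a - s * b
    lemma = solve-∀

  AllAt : Fin nV → Sign → ∀ {y z} → Tour y z → Set
  AllAt x t []                      = ⊤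
  AllAt x t (⟨_,_⟩∷_ {x'} w' t' T) = (x' ≡ x → t' ≡ t) × AllAt x t T

  -- Trails that start at the same vertex leave it with the same sign, so there is nothing left to
  -- uncross.
  Coherent : ∀ {x y} → Tour x y → Set
  Coherent []                     = ⊤
  Coherent (⟨_,_⟩∷_ {x} w t T) = AllAt x t T × Coherent T

  -- The scanned part of the tour is kept reversed: reversing a block that
  -- starts at x with sign t, up to a trail that starts at x with the opposite
  -- sign, makes the junction at the end of the block consistent.
  scan : ∀ {x y y' z} t (w : Trail y y') s (A : Tour y' x) (T : Tour y z) →
    endSign s (⟨ w , s ⟩∷ A) ≡ opposite t →
    (∃ λ (T' : Tour x z) → suc (length T') ≡ length (⟨ w , s ⟩∷ A) ℕ.+ length T
       × (∀ e → occᵀ T' e ≡ occᵀ (⟨ w , s ⟩∷ A) e ℕ.+ occᵀ T e)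
       × (∀ v → boundaryᵀ T' v ≡ boundaryᵀ (⟨ w , s ⟩∷ A) v + boundaryᵀ T v))
    ⊎ AllAt x t T
  scan t w s A [] end≡ = inj₂ tt
  scan {x} {y} t w s A (⟨ w₂ , t₂ ⟩∷ C) end≡ with (y ≟ x) ×-dec ¬? (t₂ Signₚ.≟ t)
  ... | yes (refl , t₂≢t) = inj₁
    ( extend w s A w₂ ++ᵀ C
    , cong suc (trans (length-++ᵀ (extend w s A w₂) C)
        (trans (cong (ℕ._+ length C) (length-extend w s A w₂)) (sym (ℕₚ.+-suc (length A) (length C)))))
    , (λ e → trans (occᵀ-++ᵀ (extend w s A w₂) C e)
        (trans (cong (ℕ._+ occᵀ C e) (occ-extend w s A w₂ e)) (ℕₚ.+-assoc (occᵀ (⟨ w , s ⟩∷ A) e) _ _)))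
    , (λ v → trans (boundaryᵀ-++ᵀ (extend w s A w₂) C v)
        (trans (cong (_+ boundaryᵀ C v) (boundary-extend w s A w₂ t₂ (trans (≢⇒opposite t₂≢t) (sym end≡)) v))
          (ℤₚ.+-assoc (boundaryᵀ (⟨ w , s ⟩∷ A) v) (boundary w₂ t₂ v) (boundaryᵀ C v)))))
  ... | no ¬conflict
    with scan t (reverse w₂) (opposite (sgn w₂ Sign.* t₂)) (⟨ w , s ⟩∷ A) C end≡
  ... | inj₁ (T' , l , o , b) = inj₁
    ( T' , trans l (cong suc (sym (ℕₚ.+-suc (length A) (length C))))
    , (λ e → trans (o e) (trans (cong (λ n → n ℕ.+ occᵀ (⟨ w , s ⟩∷ A) e ℕ.+ occᵀ C e) (occ-reverse w₂ e))
        (lemma (occ w₂ e) (occᵀ (⟨ w , s ⟩∷ A) e) (occᵀ C e))))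
    , (λ v → trans (b v) (trans (cong (λ n → n + boundaryᵀ (⟨ w , s ⟩∷ A) v + boundaryᵀ C v) (boundary-reverse w₂ t₂ v))
        (lemma' (boundary w₂ t₂ v) (boundaryᵀ (⟨ w , s ⟩∷ A) v) (boundaryᵀ C v)))))
    where
    lemma : ∀ a b c → a ℕ.+ b ℕ.+ c ≡ b ℕ.+ (a ℕ.+ c)
    lemma = ℕ-Solver.solve-∀
    lemma' : ∀ a b c → a + b + c ≡ b + (a + c)
    lemma' = solve-∀
  ... | inj₂ all = inj₂ ((λ y≡x → decidable-stable (t₂ Signₚ.≟ t) (λ t₂≢t → ¬conflict (y≡x , t₂≢t))) , all)

  -- Each suffix of the tour is scanned for a later trail that conflicts with the first trail of the
  -- suffix.
  uncross : ∀ {x y} (T : Tour x y) → Shorter T ⊎ Coherent T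
  uncross [] = inj₂ tt
  -- The block to be reversed is at first `w` alone, held backwards so that it arrives at its start
  -- vertex with end sign `opposite t`.
  uncross (⟨ w , t ⟩∷ T) with scan t (reverse w) (opposite (sgn w Sign.* t)) [] T end≡
    where
    end≡ : sgn (reverse w) Sign.* opposite (sgn w Sign.* t) ≡ opposite t
    end≡ rewrite sgn-reverse w = *-opposite-* (sgn w) t
  ... | inj₁ (T' , l , o , b) = inj₁ (shorter T' l
    (λ e → trans (o e) (cong (ℕ._+ occᵀ T e) (trans (ℕₚ.+-identityʳ _) (occ-reverse w e))))
    (λ v → trans (b v) (cong (_+ boundaryᵀ T v) (trans (ℤₚ.+-identityʳ (boundary (reverse w) (opposite (sgn w Sign.* t)) v)) (boundary-reverse w t v)))))
  ... | inj₂ all with uncross T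
  ...   | inj₁ s   = inj₁ (keep w t s)
  ...   | inj₂ coh = inj₂ (all , coh)

  -- Reversing the orientation of a set of trails.

  boundaries : ∀ {x y} (T : Tour x y) → Fin nV → Vec ℤ (length T)
  boundaries []              v = []
  boundaries (⟨ w , t ⟩∷ T) v = boundary w t v ∷ boundaries T v

  flip : ∀ {x y} (T : Tour x y) → Vec Bool (length T) → Tour x y
  flip []              []       = []
  flip (⟨ w , t ⟩∷ T) (b ∷ bs) = ⟨ w , (if b then opposite t else t) ⟩∷ flip T bs

  length-flip : ∀ {x y} (T : Tour x y) bs → length (flip T bs) ≡ length T
  length-flip []              []       = refl
  length-flip (⟨ w , t ⟩∷ T) (b ∷ bs) = cong suc (length-flip T bs)

  occ-flip : ∀ {x y} (T : Tour x y) bs e → occᵀ (flip T bs) e ≡ occᵀ T e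
  occ-flip []              []       e = refl
  occ-flip (⟨ w , t ⟩∷ T) (b ∷ bs) e = cong (occ w e ℕ.+_) (occ-flip T bs e)

  boundary-opposite : ∀ {x y} (w : Trail x y) t v → boundary w (opposite t) v ≡ - boundary w t v
  boundary-opposite {x} {y} w t v
    rewrite val-* (sgn w) (opposite t) | val-* (sgn w) t | val-opposite t =
    lemma (val t) (val (sgn w)) (+ δ x v) (+ δ y v)
    where
    lemma : ∀ t s a b → - t * a - (s * - t) * b ≡ - (t * a - (s * t) * b)
    lemma = solve-∀

  -- Reversing an orientation negates the boundary of that trail, so the total changes by twice the
  -- selected part. A selection with sum divisible by 3 therefore preserves divisibility.
  boundary-flip : ∀ {x y} (T : Tour x y) bs v →
                  boundaryᵀ (flip T bs) v ≡ boundaryᵀ T v - + 2 * subsetSum (boundaries T v) bs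
  boundary-flip []              []           v = refl
  boundary-flip (⟨ w , t ⟩∷ T) (false ∷ bs) v rewrite boundary-flip T bs v =
    lemma (boundary w t v) (boundaryᵀ T v) (subsetSum (boundaries T v) bs)
    where
    lemma : ∀ a b c → a + (b - + 2 * c) ≡ a + b - + 2 * (0ℤ + c)
    lemma = solve-∀
  boundary-flip (⟨ w , t ⟩∷ T) (true ∷ bs)  v rewrite boundary-flip T bs v | boundary-opposite w t v =
    lemma (boundary w t v) (boundaryᵀ T v) (subsetSum (boundaries T v) bs)
    where
    lemma : ∀ a b c → - a + (b - + 2 * c) ≡ a + b - + 2 * (a + c)
    lemma = solve-∀

  -- The first trail is never flipped, so the first selected trail follows an unselected one, and
  -- the bad junction between them becomes consistent.
  merge-flip : ∀ {x y z} (w : Trail x y) t (T : Tour y z) bs → BadAfter (sgn w Sign.* t) T →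
               bs ≢ ∅ (length T) → Shorter (⟨ w , t ⟩∷ flip T bs)
  merge-flip w t []                []           bads         bs≢∅ = contradiction refl bs≢∅
  merge-flip w t (⟨ w' , t' ⟩∷ T) (true ∷ bs)  (bad , _)    bs≢∅ =
    merge w t w' (opposite t') (flip T bs)
      (trans (cong opposite bad) (Signₚ.opposite-involutive (sgn w Sign.* t)))
  merge-flip w t (⟨ w' , t' ⟩∷ T) (false ∷ bs) (_ , bads) bs≢∅ =
    keep w t (merge-flip w' t' T bs bads (λ bs≡∅ → bs≢∅ (cong (false ∷_) bs≡∅)))

  -- Counting the starts of trails modulo 3.

  starts : ∀ {x y} → Tour x y → Fin nV → ℕ
  starts []                     v = 0
  starts (⟨_,_⟩∷_ {x} w t T) v = δ x v ℕ.+ starts T v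

  signedStarts : ∀ {x y} → Tour x y → Fin nV → ℤ
  signedStarts []                     v = 0ℤ
  signedStarts (⟨_,_⟩∷_ {x} w t T) v = val t * + δ x v + signedStarts T v

  -- When all junctions are bad, each contributes twice the sign of the trail
  -- starting there.
  boundary-bad : ∀ {y z} s (T : Tour y z) → BadAfter s T → ∀ v →
    boundaryᵀ T v - val s * + δ y v ≡ + 2 * signedStarts T v - val (endSign s T) * + δ z v
  boundary-bad s [] bads v = refl
  boundary-bad {y} {z} s (⟨_,_⟩∷_ {y = y'} w _ T) (refl , bads) v rewrite val-opposite s = begin
    (- val s * + δ y v - val s' * + δ y' v + boundaryᵀ T v) - val s * + δ y v
      ≡⟨ lemma (val s) (+ δ y v) (val s' * + δ y' v) (boundaryᵀ T v) ⟩
    (boundaryᵀ T v - val s' * + δ y' v) + + 2 * (- val s * + δ y v)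
      ≡⟨ cong (λ r → r + + 2 * (- val s * + δ y v)) (boundary-bad s' T bads v) ⟩
    (+ 2 * signedStarts T v - val (endSign s' T) * + δ z v) + + 2 * (- val s * + δ y v)
      ≡⟨ lemma' (val s) (+ δ y v) (signedStarts T v) (val (endSign s' T) * + δ z v) ⟩
    + 2 * (- val s * + δ y v + signedStarts T v) - val (endSign s' T) * + δ z v ∎
    where
    open ≡-Reasoning
    s' = sgn w Sign.* opposite s
    lemma : ∀ s d e b → (- s * d - e + b) - s * d ≡ (b - e) + + 2 * (- s * d)
    lemma = solve-∀
    lemma' : ∀ s d b e → (+ 2 * b - e) + + 2 * (- s * d) ≡ + 2 * (- s * d + b) - e
    lemma' = solve-∀

  signedStarts-AllAt : ∀ {y z} x t (T : Tour y z) → AllAt x t T → signedStarts T x ≡ val t * + starts T x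
  signedStarts-AllAt x t [] all = sym (ℤₚ.*-zeroʳ (val t))
  signedStarts-AllAt x t (⟨_,_⟩∷_ {x'} w t' T) (eq , all)
    rewrite signedStarts-AllAt x t T all | ℤₚ.pos-+ (δ x' x) (starts T x)
    with x' ≟ x
  ... | yes x'≡x rewrite eq x'≡x = sym (ℤₚ.*-distribˡ-+ (val t) 1ℤ (+ starts T x))
  ... | no _ = lemma (val t') (val t) (+ starts T x)
    where
    lemma : ∀ t' t n → t' * 0ℤ + t * n ≡ t * (0ℤ + n)
    lemma = solve-∀

  -- All trails starting at v carry one sign, so nothing cancels. The default `Sign.+` serves
  -- vertices where no trail starts.
  signedStarts-coherent : ∀ {x y} (T : Tour x y) → Coherent T → ∀ v →
                          ∃ λ s → signedStarts T v ≡ val s * + starts T v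
  signedStarts-coherent [] coh v = Sign.+ , refl
  signedStarts-coherent (⟨_,_⟩∷_ {x} w t T) (all , coh) v with x ≟ v
  ... | yes refl rewrite signedStarts-AllAt x t T all =
    t , sym (ℤₚ.*-distribˡ-+ (val t) 1ℤ (+ starts T x))
  ... | no _ with signedStarts-coherent T coh v
  ...   | s , eq rewrite eq = s , lemma (val t) (val s * + starts T v)
    where
    lemma : ∀ t n → t * 0ℤ + n ≡ n
    lemma = solve-∀

  ∑-starts : ∀ {x y} (T : Tour x y) → ∑ (starts T) ≡ length T
  ∑-starts []                     = ∑-0 nV
  ∑-starts (⟨_,_⟩∷_ {x} w t T) = trans (∑-+ (δ x) (starts T)) (cong₂ ℕ._+_ (∑-δ x) (∑-starts T))

  -- With every junction bad, the closing one included, the boundary is twice the signed count of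
  -- starts; 2 is invertible modulo 3, and coherence makes the signed count plus or minus the count.
  3∣starts : ∀ {x} (T : Tour x x) s → BadAfter s T → endSign s T ≡ s → Coherent T →
             ∀ v → + 3 ∣ boundaryᵀ T v → 3 ∣ℕ starts T v
  3∣starts {x} T s bads end coh v 3∣ with signedStarts-coherent T coh v
  ... | t , eq = ∣⇒∣ᵤ (subst (+ 3 ∣_) count (∣n⇒∣m*n (val t) 3∣signed))
    where
    lemma : ∀ a b d → a ≡ (a - d) + d
    lemma = solve-∀
    lemma' : ∀ a d → (+ 2 * a - d) + d ≡ + 2 * a
    lemma' = solve-∀
    twice : boundaryᵀ T v ≡ + 2 * signedStarts T v
    twice = trans (lemma (boundaryᵀ T v) 0ℤ (val s * + δ x v))
      (trans (cong (λ r → r + val s * + δ x v) (trans (boundary-bad s T bads v)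
                (cong (λ s → + 2 * signedStarts T v - val s * + δ x v) end)))
        (lemma' (signedStarts T v) (val s * + δ x v)))
    lemma₃ : ∀ a → a * + 3 - + 2 * a ≡ a
    lemma₃ = solve-∀
    3∣signed : + 3 ∣ signedStarts T v
    3∣signed = subst (+ 3 ∣_) (lemma₃ (signedStarts T v))
      (∣m∣n⇒∣m-n (divides (signedStarts T v) refl) (subst (+ 3 ∣_) twice 3∣))
    count : val t * signedStarts T v ≡ + starts T v
    count = trans (cong (val t *_) eq) (trans (sym (ℤₚ.*-assoc (val t) (val t) (+ starts T v)))
      (trans (cong (_* + starts T v) (val² t)) (ℤₚ.*-identityˡ (+ starts T v))))

  start≢ : ∀ {y z} (T : Tour y z) v → starts T v ≡ 0 → z ≢ v → y ≢ v
  start≢ []                     v none z≢v = z≢v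
  start≢ (⟨_,_⟩∷_ {x} w t T) v none z≢v with x ≟ v
  ... | no x≢v = x≢v

  -- Each trail ends where the next one starts or at z, so no trail has an end at v.
  subsetSum-boundaries-0 : ∀ {y z} (T : Tour y z) v → starts T v ≡ 0 → z ≢ v →
                           ∀ bs → subsetSum (boundaries T v) bs ≡ 0ℤ
  subsetSum-boundaries-0 [] v none z≢v [] = refl
  subsetSum-boundaries-0 (⟨_,_⟩∷_ {x} {y} w t T) v none z≢v (b ∷ bs)
    rewrite δ-≢ (start≢ (⟨ w , t ⟩∷ T) v none z≢v)
          | δ-≢ (start≢ T v (ℕₚ.m+n≡0⇒n≡0 (δ x v) none) z≢v)
          | subsetSum-boundaries-0 T v (ℕₚ.m+n≡0⇒n≡0 (δ x v) none) z≢v bs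
          | ℤₚ.*-zeroʳ (val t) | ℤₚ.*-zeroʳ (val (sgn w Sign.* t))
    with b
  ... | true  = refl
  ... | false = refl

  -- For n + 1 trails with k start vertices, Olson's theorem on n trails needs 2k + 1 at most n. For
  -- k at least 2 this follows from 2k + 2 being at most 3k; smaller k rely on n being at least 3.
  few-vertices : ∀ k {n} → 3 ℕ.≤ n → 3 ℕ.* k ℕ.≤ suc n → suc (2 ℕ.* k) ℕ.≤ n
  few-vertices zero          3≤n le = ℕₚ.≤-trans (s≤s z≤n) 3≤n
  few-vertices (suc zero)    3≤n le = 3≤n
  few-vertices (suc (suc k)) 3≤n le = ℕₚ.≤-pred (ℕₚ.≤-trans
    (subst (suc (suc (2 ℕ.* suc (suc k))) ℕ.≤_) (lemma k) (ℕₚ.m≤m+n _ k)) le)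
    where
    lemma : ∀ k → suc (suc (2 ℕ.* suc (suc k))) ℕ.+ k ≡ 3 ℕ.* suc (suc k)
    lemma = ℕ-Solver.solve-∀

  -- Olson's theorem is applied to all trails but the first, which makes the selection a proper
  -- subset of the tour. The active coordinates are the start vertices.
  flippable : ∀ {x y} (w : Trail x y) t (T : Tour y x) → 3 ℕ.≤ length T →
    (∀ v → 3 ∣ℕ starts (⟨ w , t ⟩∷ T) v) →
    ∃ λ bs → bs ≢ ∅ (length T) × ∀ v → + 3 ∣ subsetSum (boundaries T v) bs
  flippable {x} w t T long 3∣ = olson₃ (boundaries T) active inactive enough
    where
    T' = ⟨ w , t ⟩∷ T
    active : Fin nV → Bool
    active v = positive (starts T' v)
    inactive : ∀ v → active v ≡ false → ∀ bs → subsetSum (boundaries T v) bs ≡ 0ℤ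
    inactive v act = subsetSum-boundaries-0 T v (ℕₚ.m+n≡0⇒n≡0 (δ x v) none)
      -- The tour is closed, so its end vertex x is also a start and cannot be inactive.
      (λ { refl → contradiction (trans (sym (δ-refl x)) (ℕₚ.m+n≡0⇒m≡0 (δ x x) none)) λ () })
      where
      none : starts T' v ≡ 0
      none = ¬positive⇒0 (starts T' v) act
    2bit : ∀ b → (if b then 2 else 0) ≡ 2 ℕ.* bit b
    2bit true  = refl
    2bit false = refl
    enough : suc (∑ (λ v → if active v then 2 else 0)) ℕ.≤ length T
    enough = subst (λ k → suc k ℕ.≤ length T)
      (sym (trans (∑-cong (λ v → 2bit (active v))) (∑-* 2 (λ v → bit (active v)))))
      (few-vertices (∑ (λ v → bit (active v))) long
        (subst₂ ℕ._≤_ (∑-* 3 (λ v → bit (active v))) (∑-starts T') (∑-mono (λ v → 3∣⇒3*positive≤ (starts T' v) (3∣ v)))))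

  -- The reduction of tours.

  data Reduct : Set where
    closed : ∀ {x} (w : Trail x x) → sgn w ≡ Sign.+ → (∀ e → occ w e ≡ 1) → Reduct
    triple : ∀ {x} (w : Fin 3 → Trail x x) → (∀ i → sgn (w i) ≡ Sign.-) →
             (∀ e → ∑ (λ i → occ (w i) e) ≡ 1) → Reduct

  fixed⇒+ : ∀ s t → t ≡ s Sign.* t → s ≡ Sign.+
  fixed⇒+ Sign.+ t      eq = refl
  fixed⇒+ Sign.- Sign.+ ()
  fixed⇒+ Sign.- Sign.- ()

  opposite⇒- : ∀ s t → t ≡ opposite (s Sign.* t) → s ≡ Sign.-
  opposite⇒- Sign.- t      eq = refl
  opposite⇒- Sign.+ Sign.+ ()
  opposite⇒- Sign.+ Sign.- ()

  -- The first vertex is the start of a positive multiple of 3 trails, which excludes one or two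
  -- trails and makes three trails closed at that vertex. With four or more, a flip allows a merge,
  -- and `rec` handles the shorter tour.
  reduce-bad : ∀ n → (∀ {x} (T : Tour x x) → length T ℕ.≤ n → (∀ e → occᵀ T e ≡ 1) →
                       (∀ v → + 3 ∣ boundaryᵀ T v) → Reduct) →
    ∀ {x y} (w : Trail x y) t (T : Tour y x) → length T ℕ.≤ n → (∀ e → occᵀ (⟨ w , t ⟩∷ T) e ≡ 1) →
    (∀ v → + 3 ∣ boundaryᵀ (⟨ w , t ⟩∷ T) v) → t ≡ opposite (endSign (sgn w Sign.* t) T) →
    BadAfter (sgn w Sign.* t) T → Coherent (⟨ w , t ⟩∷ T) →
    (∀ v → 3 ∣ℕ starts (⟨ w , t ⟩∷ T) v) → Reduct
  reduce-bad n rec {x} w t [] len o b bad bads coh 3∣ with subst (λ k → 3 ∣ℕ k ℕ.+ 0) (δ-refl x) (3∣ x)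
  ... | 3∣1 = contradiction 3∣1 (toWitnessFalse {a? = 3 ∣ℕ? 1} tt)
  reduce-bad n rec {x} w t (⟨_,_⟩∷_ {y} w₁ t₁ []) len o b bad bads coh 3∣
    with y ≟ x | subst (λ k → 3 ∣ℕ k ℕ.+ (δ y x ℕ.+ 0)) (δ-refl x) (3∣ x)
  ... | yes _ | 3∣2 = contradiction 3∣2 (toWitnessFalse {a? = 3 ∣ℕ? 2} tt)
  ... | no _  | 3∣1 = contradiction 3∣1 (toWitnessFalse {a? = 3 ∣ℕ? 1} tt)
  reduce-bad n rec {x} w t (⟨_,_⟩∷_ {y} w₁ t₁ (⟨_,_⟩∷_ {z} w₂ t₂ [])) len o b bad (bad₁ , bad₂ , _) ((all₁ , all₂ , _) , _) 3∣
    with y ≟ x | z ≟ x | subst (λ k → 3 ∣ℕ k ℕ.+ (δ y x ℕ.+ (δ z x ℕ.+ 0))) (δ-refl x) (3∣ x)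
  ... | no _  | no _  | 3∣1 = contradiction 3∣1 (toWitnessFalse {a? = 3 ∣ℕ? 1} tt)
  ... | no _  | yes _ | 3∣2 = contradiction 3∣2 (toWitnessFalse {a? = 3 ∣ℕ? 2} tt)
  ... | yes _ | no _  | 3∣2 = contradiction 3∣2 (toWitnessFalse {a? = 3 ∣ℕ? 2} tt)
  -- Coherence makes the three starting signs equal, so each bad junction forces the trail before it
  -- to have sign `Sign.-`.
  ... | yes refl | yes refl | _ with all₁ refl | all₂ refl
  ...   | refl | refl = triple ws odd o
    where
    ws : Fin 3 → Trail x x
    ws zero             = w
    ws (suc zero)       = w₁
    ws (suc (suc zero)) = w₂
    odd : ∀ i → sgn (ws i) ≡ Sign.-
    odd zero             = opposite⇒- (sgn w) t bad₁
    odd (suc zero)       = opposite⇒- (sgn w₁) t bad₂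
    odd (suc (suc zero)) = opposite⇒- (sgn w₂) t bad
  reduce-bad n rec w t T@(⟨ _ , _ ⟩∷ ⟨ _ , _ ⟩∷ ⟨ _ , _ ⟩∷ _) len o b bad bads coh 3∣
    with flippable w t T (s≤s (s≤s (s≤s z≤n))) 3∣
  ... | bs , bs≢∅ , 3∣bs with merge-flip w t T bs bads bs≢∅
  ...   | shorter T' l o' b' = rec T'
    (subst (ℕ._≤ n) (sym (ℕₚ.suc-injective (trans l (cong suc (length-flip T bs))))) len)
    (λ e → trans (o' e) (trans (cong (occ w e ℕ.+_) (occ-flip T bs e)) (o e)))
    (λ v → subst (+ 3 ∣_) (sym (trans (b' v) (trans (cong (λ r → boundary w t v + r) (boundary-flip T bs v))
              (sym (ℤₚ.+-assoc (boundary w t v) (boundaryᵀ T v) (- (+ 2 * subsetSum (boundaries T v) bs)))))))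
      (∣m∣n⇒∣m-n (b v) (∣n⇒∣m*n (+ 2) (3∣bs v))))

  reduce : ∀ n {x} (T : Tour x x) → length T ℕ.≤ n → (∀ e → occᵀ T e ≡ 1) →
           (∀ v → + 3 ∣ boundaryᵀ T v) → Reduct
  reduce-shorter : ∀ n {x} {T : Tour x x} → length T ℕ.≤ suc n → (∀ e → occᵀ T e ≡ 1) →
                   (∀ v → + 3 ∣ boundaryᵀ T v) → Shorter T → Reduct

  reduce-shorter n len o b (shorter T' l o' b') = reduce n T'
    (ℕₚ.≤-pred (subst (ℕ._≤ suc n) (sym l) len))
    (λ e → trans (o' e) (o e)) (λ v → subst (+ 3 ∣_) (sym (b' v)) (b v))

  -- An empty tour can use every edge once only when the graph has no edges.
  reduce n {x}   []              len o b = closed {x} [] refl o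
  reduce (suc n) (⟨ w , t ⟩∷ T) len o b with merge-junction w t T
  ... | inj₁ s = reduce-shorter n len o b s
  ... | inj₂ bads with t Signₚ.≟ endSign (sgn w Sign.* t) T | uncross (⟨ w , t ⟩∷ T)
  ...   | _ | inj₁ s = reduce-shorter n len o b s
  ...   | no t≢ | inj₂ coh = reduce-bad n (reduce n) w t T (ℕₚ.≤-pred len) o b bad bads coh
    (λ v → 3∣starts (⟨ w , t ⟩∷ T) (endSign (sgn w Sign.* t) T) (bad , bads) refl coh v (b v))
    where
    bad : t ≡ opposite (endSign (sgn w Sign.* t) T)
    bad = ≢⇒opposite t≢
  reduce (suc n) (⟨ w , t ⟩∷ []) len o b | inj₂ bads | yes t≡ | inj₂ coh =
    closed w (fixed⇒+ (sgn w) t t≡) (λ e → trans (sym (ℕₚ.+-identityʳ (occ w e))) (o e))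
  -- The closing junction is consistent: rotate the tour to start with the second trail, and glue
  -- the first trail to the end of the last.
  reduce (suc n) (⟨ w , t ⟩∷ ⟨ w₁ , t₁ ⟩∷ T) len o b | inj₂ bads | yes t≡ | inj₂ coh =
    reduce n (extend w₁ t₁ T w)
      (subst (ℕ._≤ n) (sym (length-extend w₁ t₁ T w)) (ℕₚ.≤-pred len))
      (λ e → trans (occ-extend w₁ t₁ T w e)
        (trans (ℕₚ.+-comm (occᵀ (⟨ w₁ , t₁ ⟩∷ T) e) (occ w e)) (o e)))
      (λ v → subst (+ 3 ∣_) (sym (trans (boundary-extend w₁ t₁ T w t t≡ v)
        (ℤₚ.+-comm (boundaryᵀ (⟨ w₁ , t₁ ⟩∷ T) v) (boundary w t v)))) (b v))

  -- Flows

  half-sign : Orientation G → Fin nE → Bool → Sign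
  half-sign ω e b = if ω e b then Sign.- else Sign.+

  -- An entry of the signed incidence matrix; a loop contributes through both of its half-edges.
  incidence : Orientation G → Fin nV → Fin nE → ℤ
  incidence ω v e = val (half-sign ω e false) * + δ (end e false) v + val (half-sign ω e true) * + δ (end e true) v

  outflow-incidence : ∀ ω ξ v → outflow G ω ξ v ≡ ∑ℤ (λ e → ξ e * incidence ω v e)
  outflow-incidence ω ξ v = ∑ℤ-cong λ e → trans
    (cong₂ _+_ (half (does (end e false ≟ v)) (ω e false) (ξ e)) (half (does (end e true ≟ v)) (ω e true) (ξ e)))
    (sym (ℤₚ.*-distribˡ-+ (ξ e) (val (half-sign ω e false) * + δ (end e false) v) (val (half-sign ω e true) * + δ (end e true) v)))
    where
    half : ∀ d o x → (if d then (if o then - x else x) else 0ℤ) ≡ x * (val (if o then Sign.- else Sign.+) * + bit d)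
    half true  true  x = trans (sym (ℤₚ.-1*i≡-i x)) (ℤₚ.*-comm (- 1ℤ) x)
    half true  false x = sym (ℤₚ.*-identityʳ x)
    half false true  x = sym (ℤₚ.*-zeroʳ x)
    half false false x = sym (ℤₚ.*-zeroʳ x)

  defaultOrientation : Orientation G
  defaultOrientation e b = orient (σ e)
    where
    orient : Sign → Bool
    orient Sign.+ = b
    orient Sign.- = true

  defaultOrientation-valid : ValidOrientation G defaultOrientation
  defaultOrientation-valid e with σ e in eq
  ... | Sign.+ rewrite eq = λ ()
  ... | Sign.- rewrite eq = refl

  half-sign-not : ∀ ω → ValidOrientation G ω → ∀ e b →
                  half-sign ω e (not b) ≡ opposite (σ e Sign.* half-sign ω e b)
  half-sign-not ω valid e b with σ e | valid e
  half-sign-not ω valid e true  | Sign.- | eq rewrite eq = sym (Signₚ.opposite-involutive _)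
  half-sign-not ω valid e false | Sign.- | eq rewrite eq = sym (Signₚ.opposite-involutive _)
  half-sign-not ω valid e true  | Sign.+ | ≢ = ends-differ (≢ ∘ sym)
  half-sign-not ω valid e false | Sign.+ | ≢ = ends-differ ≢

  module _ (ω : Orientation G) (valid : ValidOrientation G ω) where

    incidence-dart : ∀ v e b → incidence ω v e ≡
      val (half-sign ω e b) * (+ δ (end e b) v - val (σ e) * + δ (end e (not b)) v)
    incidence-dart v e false
      rewrite half-sign-not ω valid e false | val-opposite (σ e Sign.* half-sign ω e false)
            | val-* (σ e) (half-sign ω e false) =
      lemma (val (half-sign ω e false)) (val (σ e)) (+ δ (end e false) v) (+ δ (end e true) v)
      where
      lemma : ∀ h s a b → h * a + - (s * h) * b ≡ h * (a - s * b)
      lemma = solve-∀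
    incidence-dart v e true
      rewrite half-sign-not ω valid e true | val-opposite (σ e Sign.* half-sign ω e true)
            | val-* (σ e) (half-sign ω e true) =
      lemma (val (half-sign ω e true)) (val (σ e)) (+ δ (end e false) v) (+ δ (end e true) v)
      where
      lemma : ∀ h s a b → - (s * h) * a + h * b ≡ h * (b - s * a)
      lemma = solve-∀

    -- The initial tour of the reduction, with each dart as a trail of its own.
    dartTour : (t : Dart → Sign) → ∀ {x y} → Trail x y → Tour x y
    dartTour t []      = []
    dartTour t (d ∷ w) = ⟨ d ∷ [] , t d ⟩∷ dartTour t w

    occ-dartTour : ∀ t {x y} (w : Trail x y) e → occᵀ (dartTour t w) e ≡ occ w e
    occ-dartTour t []             e = refl
    occ-dartTour t ((e' , _) ∷ w) e = cong₂ ℕ._+_ (ℕₚ.+-identityʳ (δ e' e)) (occ-dartTour t w e)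

    boundary-dartTour : ∀ k (ξ : Fin nE → ℤ) (t : Dart → Sign) → (∀ e b → k ∣ val (t (e , b)) - ξ e * val (half-sign ω e b)) →
      ∀ {x y} (w : Trail x y) v →
      k ∣ boundaryᵀ (dartTour t w) v - ∑trail (λ e → ξ e * incidence ω v e) w
    boundary-dartTour k ξ t cong-t [] v = divides 0ℤ refl
    boundary-dartTour k ξ t cong-t ((e , b) ∷ w) v = subst (k ∣_) eq
      (∣m∣n⇒∣m+n (∣m⇒∣m*n (+ δ (end e b) v - val (σ e) * + δ (end e (not b)) v) (cong-t e b))
                 (boundary-dartTour k ξ t cong-t w v))
      where
      lemma : ∀ t x h s a b r q → (t - x * h) * (a - s * b) + (r - q)
                                ≡ ((t * a - (s * t) * b) + r) - (x * (h * (a - s * b)) + q)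
      lemma = solve-∀
      eq : (val (t (e , b)) - ξ e * val (half-sign ω e b)) * (+ δ (end e b) v - val (σ e) * + δ (end e (not b)) v)
             + (boundaryᵀ (dartTour t w) v - ∑trail (λ e → ξ e * incidence ω v e) w)
         ≡ boundaryᵀ (dartTour t ((e , b) ∷ w)) v - (ξ e * incidence ω v e + ∑trail (λ e → ξ e * incidence ω v e) w)
      eq rewrite incidence-dart v e b | Signₚ.*-identityʳ (σ e) | val-* (σ e) (t (e , b)) =
        lemma (val (t (e , b))) (ξ e) (val (half-sign ω e b)) (val (σ e)) (+ δ (end e b) v)
              (+ δ (end e (not b)) v) (boundaryᵀ (dartTour t w) v) (∑trail (λ e → ξ e * incidence ω v e) w)

    -- The consistent orientation of the trail expressed relative to ω: an edge gets the product of
    -- the sign with which the trail leaves along it and its sign under ω.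
    trailFlow : ∀ {x y} → Trail x y → Sign → Fin nE → ℤ
    trailFlow []            t e' = 0ℤ
    trailFlow ((e , b) ∷ w) t e' = + δ e e' * (val t * val (half-sign ω e b)) + trailFlow w (σ e Sign.* t) e'

    -- The sign under ω enters twice and squares to 1; what remains telescopes along the trail.
    ∑-trailFlow : ∀ {x y} (w : Trail x y) t v → ∑ℤ (λ e → trailFlow w t e * incidence ω v e) ≡ boundary w t v
    ∑-trailFlow {x} [] t v = trans (∑ℤ-0 nE) (sym (ℤₚ.+-inverseʳ (val t * + δ x v)))
    ∑-trailFlow {y = y} ((e , b) ∷ w) t v = begin
      ∑ℤ (λ e' → (+ δ e e' * c + trailFlow w t' e') * I e')
        ≡⟨ ∑ℤ-cong (λ e' → lemma (+ δ e e') c (trailFlow w t' e') (I e')) ⟩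
      ∑ℤ (λ e' → + δ e e' * (c * I e') + trailFlow w t' e' * I e')
        ≡⟨ ∑ℤ-+ (λ e' → + δ e e' * (c * I e')) (λ e' → trailFlow w t' e' * I e') ⟩
      ∑ℤ (λ e' → + δ e e' * (c * I e')) + ∑ℤ (λ e' → trailFlow w t' e' * I e')
        ≡⟨ cong₂ _+_ (∑ℤ-δ e (λ e' → c * I e')) (∑-trailFlow w t' v) ⟩
      c * I e + boundary w t' v
        ≡⟨ cong (λ r → c * r + boundary w t' v) (incidence-dart v e b) ⟩
      c * (h * (+ δ (end e b) v - val (σ e) * + δ (end e (not b)) v)) + boundary w t' v
        ≡⟨ lemma₂ (val t) h (+ δ (end e b) v) (val (σ e)) (+ δ (end e (not b)) v) (boundary w t' v) ⟩
      (h * h) * (val t * + δ (end e b) v - (val (σ e) * val t) * + δ (end e (not b)) v) + boundary w t' v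
        ≡⟨ cong₂ (λ r s → r * (val t * + δ (end e b) v - s * + δ (end e (not b)) v) + boundary w t' v)
             (val² (half-sign ω e b)) (sym (val-* (σ e) t)) ⟩
      1ℤ * (val t * + δ (end e b) v - val t' * + δ (end e (not b)) v) + boundary w t' v
        ≡⟨ lemma₃ (val t * + δ (end e b) v) (val t' * + δ (end e (not b)) v) (val (sgn w Sign.* t') * + δ y v) ⟩
      val t * + δ (end e b) v - val (sgn w Sign.* t') * + δ y v
        ≡⟨ cong (λ s → val t * + δ (end e b) v - val s * + δ y v)
             (trans (sym (Signₚ.*-assoc (sgn w) (σ e) t)) (cong (Sign._* t) (Signₚ.*-comm (sgn w) (σ e)))) ⟩
      boundary ((e , b) ∷ w) t v ∎
      where
      open ≡-Reasoning
      t' = σ e Sign.* t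
      h = val (half-sign ω e b)
      c = val t * h
      I = incidence ω v
      lemma : ∀ d c f i → (d * c + f) * i ≡ d * (c * i) + f * i
      lemma = solve-∀
      lemma₂ : ∀ t h a s b r → (t * h) * (h * (a - s * b)) + r ≡ (h * h) * (t * a - (s * t) * b) + r
      lemma₂ = solve-∀
      lemma₃ : ∀ a b c → 1ℤ * (a - b) + (b - c) ≡ a - c
      lemma₃ = solve-∀

    trailFlow-0 : ∀ {x y} (w : Trail x y) t e → occ w e ≡ 0 → trailFlow w t e ≡ 0ℤ
    trailFlow-0 []            t e' occ≡0 = refl
    trailFlow-0 ((e , b) ∷ w) t e' occ≡0 with e ≟ e'
    ... | no _ = trans (ℤₚ.+-identityˡ _) (trailFlow-0 w (σ e Sign.* t) e' occ≡0)

    trailFlow-1 : ∀ {x y} (w : Trail x y) t e → occ w e ≡ 1 → ∃ λ s → trailFlow w t e ≡ val s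
    trailFlow-1 ((e , b) ∷ w) t e' occ≡1 with e ≟ e'
    ... | no _ with trailFlow-1 w (σ e Sign.* t) e' occ≡1
    ...   | s , eq = s , trans (ℤₚ.+-identityˡ _) eq
    trailFlow-1 ((e , b) ∷ w) t e' occ≡1 | yes _ =
      t Sign.* half-sign ω e b , trans
        (cong (λ r → 1ℤ * (val t * val (half-sign ω e b)) + r) (trailFlow-0 w (σ e Sign.* t) e' (ℕₚ.suc-injective occ≡1)))
        (trans (ℤₚ.+-identityʳ _) (trans (ℤₚ.*-identityˡ _) (sym (val-* t (half-sign ω e b)))))

  -- Parity of negative edges, and closed trails as eulerian subgraphs.

  negative : Fin nE → ℤ
  negative e = + bit (isNeg G e)

  parity : Sign → ℤ
  parity Sign.+ = 0ℤ
  parity Sign.- = 1ℤ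

  negCount-∑on : ∀ S → + negCount G S ≡ ∑on S negative
  negCount-∑on S = trans (+-∑ (λ e → if S e ∧ isNeg G e then 1 else 0)) (∑ℤ-cong lemma)
    where
    lemma : ∀ e → + (if S e ∧ isNeg G e then 1 else 0) ≡ + bit (S e) * negative e
    lemma e with S e
    ... | true  = sym (ℤₚ.*-identityˡ (negative e))
    ... | false = refl

  ∑trail-negative : ∀ {x y} (w : Trail x y) → + 2 ∣ ∑trail negative w - parity (sgn w)
  ∑trail-negative []            = divides 0ℤ refl
  ∑trail-negative ((e , _) ∷ w) with σ e
  ... | Sign.+ = subst (λ r → + 2 ∣ r - parity (sgn w)) (sym (ℤₚ.+-identityˡ (∑trail negative w))) (∑trail-negative w)
  ... | Sign.- with sgn w | ∑trail-negative w
  ...   | Sign.+ | 2∣ = subst (+ 2 ∣_) (lemma (∑trail negative w)) 2∣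
    where
    lemma : ∀ r → r - 0ℤ ≡ (1ℤ + r) - 1ℤ
    lemma = solve-∀
  ...   | Sign.- | 2∣ = subst (+ 2 ∣_) (lemma (∑trail negative w)) (∣m∣n⇒∣m+n 2∣ (divides 1ℤ refl))
    where
    lemma : ∀ r → (r - 1ℤ) + + 2 ≡ (1ℤ + r) - 0ℤ
    lemma = solve-∀

  module _ {S : EdgeSet G} {x y} (w : Trail x y) (covers : ∀ e → occ w e ≡ bit (S e)) where

    ∑on-covered : ∀ F → ∑on S F ≡ ∑trail F w
    ∑on-covered F = trans (∑ℤ-cong (λ e → cong (λ n → + n * F e) (sym (covers e)))) (∑-occ F w)

    negCount-parity : + 2 ∣ + negCount G S - parity (sgn w)
    negCount-parity = subst (λ r → + 2 ∣ r - parity (sgn w))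
      (sym (trans (negCount-∑on S) (∑on-covered negative))) (∑trail-negative w)

    odd⇒- : ¬ (2 ∣ℕ negCount G S) → sgn w ≡ Sign.-
    odd⇒- odd with sgn w | negCount-parity
    ... | Sign.- | _  = refl
    ... | Sign.+ | 2∣ = contradiction (∣⇒∣ᵤ (subst (+ 2 ∣_) (ℤₚ.+-identityʳ (+ negCount G S)) 2∣)) odd

    -⇒odd : sgn w ≡ Sign.- → ¬ (2 ∣ℕ negCount G S)
    -⇒odd neg 2∣N with subst (λ s → + 2 ∣ + negCount G S - parity s) neg negCount-parity
    ... | 2∣N-1 = contradiction (∣m+n∣m⇒∣n {m = + negCount G S} 2∣N-1 (∣ᵤ⇒∣ 2∣N)) (toWitnessFalse {a? = + 2 ∣? (- 1ℤ)} tt)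

  toWalk : ∀ {S x y} (w : Trail x y) → (∀ e → occ w e ≢ 0 → S e ≡ true) → Walk G S x y
  toWalk {x = x} []     inS = here x
  toWalk ((e , b) ∷ w) inS = step e b (inS e (λ eq → contradiction (trans (cong (ℕ._+ occ w e) (sym (δ-refl e))) eq) λ ()))
    (toWalk w (λ e' occ≢0 → inS e' (λ eq → occ≢0 (ℕₚ.m+n≡0⇒n≡0 (δ e e') eq))))

  module _ {S : EdgeSet G} {x} (w : Trail x x) (covers : ∀ e → occ w e ≡ bit (S e)) where

    -- Two vertices on the trail are joined by following it from the first one to the base vertex x
    -- and then from x to the second. Degrees are even because the trail is closed.
    closedTrail-eulerian : EulerianSub G S
    closedTrail-eulerian = connected , even
      where
      inS : ∀ e → occ w e ≢ 0 → S e ≡ true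
      inS e occ≢0 with S e | covers e
      ... | true  | _  = refl
      ... | false | eq = contradiction eq occ≢0
      on-trail : ∀ {u} → Incident G S u → Through u w
      on-trail (e , Se , b , refl) = through-end e b w
        (λ occ≡0 → contradiction (trans (sym occ≡0) (trans (covers e) (cong bit Se))) λ ())
      connected : ∀ u u' → Incident G S u → Incident G S u' → Walk G S u u'
      connected u u' inc inc' with on-trail inc | on-trail inc'
      ... | w₁ , w₂ , eq | w₁' , w₂' , eq' = toWalk (w₂ ++ w₁') λ e occ≢0 → inS e λ occ≡0 →
        occ≢0 (trans (occ-++ w₂ w₁' e) (cong₂ ℕ._+_
          (ℕₚ.m+n≡0⇒n≡0 (occ w₁ e) (trans (eq e) occ≡0))
          (ℕₚ.m+n≡0⇒m≡0 (occ w₁' e) (trans (eq' e) occ≡0))))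
      even : ∀ v → 2 ∣ℕ deg G S v
      even v = ∣⇒∣ᵤ (subst (+ 2 ∣_)
        (trans (lemma (∑trail (ends v) w) (+ δ x v)) (sym (trans (deg-∑on S v) (∑on-covered w covers (ends v)))))
        (∣m∣n⇒∣m-n (∑trail-ends v w) (divides (+ δ x v) refl)))
        where
        lemma : ∀ t d → ((t + d) + d) - d * + 2 ≡ t
        lemma = solve-∀

  -- The empty trail has sign `Sign.+`, so here there is a first edge, and it lies at x.
  negative⇒incident : ∀ {S x y} (w : Trail x y) → (∀ e → occ w e ≡ bit (S e)) → sgn w ≡ Sign.- → Incident G S x
  negative⇒incident {S} ((e , b) ∷ w) covers neg = e , Se , b , refl
    where
    Se : S e ≡ true
    Se with S e | covers e
    ... | true  | _  = refl
    ... | false | eq = contradiction (trans (cong (ℕ._+ occ w e) (sym (δ-refl e))) eq) λ ()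

  -- From a 3-flow to a 2-flow or a decomposition.

  selected : ∀ k (f : Fin k → ℕ) → ∑ f ≡ 1 → ∃ λ c → ∀ i → f i ≡ bit (does (c ≟ i))
  selected (suc k) f eq with f zero in eq₀
  ... | zero with selected k (f ∘ suc) eq
  ...   | c , sel = suc c , λ { zero → eq₀ ; (suc i) → sel i }
  selected (suc k) f eq | suc zero = zero , λ { zero → eq₀ ; (suc i) → ∑≡0 k (f ∘ suc) (ℕₚ.suc-injective eq) i }
    where
    ∑≡0 : ∀ k (f : Fin k → ℕ) → ∑ f ≡ 0 → ∀ i → f i ≡ 0
    ∑≡0 (suc k) f eq zero    = ℕₚ.m+n≡0⇒m≡0 (f zero) eq
    ∑≡0 (suc k) f eq (suc i) = ∑≡0 k (f ∘ suc) (ℕₚ.m+n≡0⇒n≡0 (f zero) eq) i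

  -- Every edge lies on exactly one of the trails, and the index of that trail is its colour.
  triple⇒decomposable : ∀ {x} (w : Fin 3 → Trail x x) → (∀ i → sgn (w i) ≡ Sign.-) →
                        (∀ e → ∑ (λ i → occ (w i) e) ≡ 1) → Decomposable G
  triple⇒decomposable {x} w neg once = c , x , λ i →
    closedTrail-eulerian (w i) (covers i) , -⇒odd (w i) (covers i) (neg i) , negative⇒incident (w i) (covers i) (neg i)
    where
    c : Fin nE → Fin 3
    c e = proj₁ (selected 3 (λ i → occ (w i) e) (once e))
    covers : ∀ i e → occ (w i) e ≡ bit (colourClass G c i e)
    covers i e = proj₂ (selected 3 (λ i → occ (w i) e) (once e)) i

  -- Sign `Sign.+` makes the two boundary terms at x cancel, so the trail itself carries a flow with
  -- values 1 and -1.
  closed⇒2-flow : ∀ {x} (w : Trail x x) → sgn w ≡ Sign.+ → (∀ e → occ w e ≡ 1) → HasNZFlow G 2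
  closed⇒2-flow {x} w pos once = ω , valid , ξ , flow , nonzero
    where
    ω = defaultOrientation
    valid = defaultOrientation-valid
    ξ = trailFlow ω valid w Sign.+
    flow : IsFlow G ω ξ
    flow v = trans (outflow-incidence ω ξ v) (trans (∑-trailFlow ω valid w Sign.+ v)
      (trans (cong (λ s → 1ℤ * + δ x v - val (s Sign.* Sign.+) * + δ x v) pos) (ℤₚ.+-inverseʳ (1ℤ * + δ x v))))
    nonzero : ∀ e → ξ e ≢ 0ℤ × ∣ ξ e ∣ ℕ.< 2
    nonzero e with trailFlow-1 ω valid w Sign.+ e (once e)
    ... | s , eq rewrite eq = val≢0 s , s≤s (ℕₚ.≤-reflexive (∣val∣ s))

  3-flow⇒ : Eulerian G → HasNZFlow G 3 → HasNZFlow G 2 ⊎ Decomposable G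
  3-flow⇒ ((0<nV , conn) , even) (ω , valid , ξ , flow , nz)
    with euler-tour (allEdges G) (fromℕ< 0<nV) (λ e _ → conn _ _) even
  ... | w , once with reduce (length T) T ℕₚ.≤-refl (λ e → trans (occ-dartTour ω valid t w e) (once e)) 3∣
    where
    t : Dart → Sign
    t (e , b) = proj₁ (residue₃ (half-sign ω e b) (proj₁ (nz e)) (proj₂ (nz e)))
    T = dartTour ω valid t w
    3∣ : ∀ v → + 3 ∣ boundaryᵀ T v
    3∣ v = subst (+ 3 ∣_) (trans (cong (λ r → boundaryᵀ T v - r) zero-sum) (ℤₚ.+-identityʳ (boundaryᵀ T v)))
      (boundary-dartTour ω valid (+ 3) ξ t (λ e b → proj₂ (residue₃ (half-sign ω e b) (proj₁ (nz e)) (proj₂ (nz e)))) w v)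
      where
      -- The tour uses each edge once, so this sum is the outflow of ξ at v.
      zero-sum : ∑trail (λ e → ξ e * incidence ω v e) w ≡ 0ℤ
      zero-sum = trans (sym (∑-occ (λ e → ξ e * incidence ω v e) w))
        (trans (∑ℤ-cong (λ e → trans (cong (λ n → + n * (ξ e * incidence ω v e)) (once e)) (ℤₚ.*-identityˡ _)))
          (trans (sym (outflow-incidence ω ξ v)) (flow v)))
  ...   | closed w' pos once' = inj₁ (closed⇒2-flow w' pos once')
  ...   | triple ws neg once' = inj₂ (triple⇒decomposable ws neg once')

  -- From a decomposition to a 3-flow, and the odd total of negative edges.

  module _ (c : Fin nE → Fin 3) (v : Fin nV) (parts : ∀ i → EulerianSub G (colourClass G c i)
           × ¬ (2 ∣ℕ negCount G (colourClass G c i)) × Incident G (colourClass G c i) v) where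

    class-tour : ∀ i → ∃ λ (w : Trail v v) → ∀ e → occ w e ≡ bit (colourClass G c i e)
    class-tour i with parts i
    ... | (conn , even) , _ , inc = euler-tour (colourClass G c i) v
      (λ e Se → conn v (end e false) inc (e , Se , false , refl)) even

    w : Fin 3 → Trail v v
    w i = proj₁ (class-tour i)

    covers : ∀ i e → occ (w i) e ≡ bit (colourClass G c i e)
    covers i = proj₂ (class-tour i)

    odd : ∀ i → sgn (w i) ≡ Sign.-
    odd i = odd⇒- (w i) (covers i) (proj₁ (proj₂ (parts i)))

    decomposable⇒3-flow : HasNZFlow G 3
    decomposable⇒3-flow = ω , valid , ξ , flow , nonzero
      where
      ω = defaultOrientation
      valid = defaultOrientation-valid
      f : Fin 3 → Fin nE → ℤ
      f i = trailFlow ω valid (w i) Sign.+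
      f₀ = f zero
      f₁ = f (suc zero)
      f₂ = f (suc (suc zero))
      ξ : Fin nE → ℤ
      -- Each summand has outflow 2 at v and 0 elsewhere, and the coefficients 1, 1, -2 add up to 0.
      -- The colour classes are disjoint, so the values have modulus 1 on two classes and 2 on the
      -- third.
      ξ e = f₀ e + f₁ e - + 2 * f₂ e
      flow : IsFlow G ω ξ
      flow u = begin
        outflow G ω ξ u
          ≡⟨ outflow-incidence ω ξ u ⟩
        ∑ℤ (λ e → ξ e * I e)
          ≡⟨ ∑ℤ-cong (λ e → lemma (f₀ e) (f₁ e) (f₂ e) (I e)) ⟩
        ∑ℤ (λ e → (f₀ e * I e + f₁ e * I e) + - + 2 * (f₂ e * I e))
          ≡⟨ ∑ℤ-+ (λ e → f₀ e * I e + f₁ e * I e) (λ e → - + 2 * (f₂ e * I e)) ⟩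
        ∑ℤ (λ e → f₀ e * I e + f₁ e * I e) + ∑ℤ (λ e → - + 2 * (f₂ e * I e))
          ≡⟨ cong₂ _+_ (∑ℤ-+ (λ e → f₀ e * I e) (λ e → f₁ e * I e)) (∑ℤ-* (- + 2) (λ e → f₂ e * I e)) ⟩
        (∑ℤ (λ e → f₀ e * I e) + ∑ℤ (λ e → f₁ e * I e)) + - + 2 * ∑ℤ (λ e → f₂ e * I e)
          ≡⟨ cong₂ _+_ (cong₂ _+_ (source zero) (source (suc zero))) (cong (- + 2 *_) (source (suc (suc zero)))) ⟩
        ((1ℤ * + δ v u - - 1ℤ * + δ v u) + (1ℤ * + δ v u - - 1ℤ * + δ v u)) + - + 2 * (1ℤ * + δ v u - - 1ℤ * + δ v u)
          ≡⟨ lemma₂ (1ℤ * + δ v u - - 1ℤ * + δ v u) ⟩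
        0ℤ ∎
        where
        open ≡-Reasoning
        I = incidence ω u
        lemma : ∀ a b c i → (a + b - + 2 * c) * i ≡ (a * i + b * i) + - + 2 * (c * i)
        lemma = solve-∀
        lemma₂ : ∀ a → (a + a) + - + 2 * a ≡ 0ℤ
        lemma₂ = solve-∀
        source : ∀ i → ∑ℤ (λ e → f i e * I e) ≡ 1ℤ * + δ v u - - 1ℤ * + δ v u
        source i = trans (∑-trailFlow ω valid (w i) Sign.+ u)
          (cong (λ s → 1ℤ * + δ v u - val (s Sign.* Sign.+) * + δ v u) (odd i))
      nonzero : ∀ e → ξ e ≢ 0ℤ × ∣ ξ e ∣ ℕ.< 3
      nonzero e with c e | covers zero e | covers (suc zero) e | covers (suc (suc zero)) e
      ... | zero | o₀ | o₁ | o₂ with trailFlow-1 ω valid (w zero) Sign.+ e o₀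
      ...   | s , eq rewrite eq | trailFlow-0 ω valid (w (suc zero)) Sign.+ e o₁
                           | trailFlow-0 ω valid (w (suc (suc zero))) Sign.+ e o₂ with s
      ...     | Sign.+ = (λ ()) , s≤s (s≤s z≤n)
      ...     | Sign.- = (λ ()) , s≤s (s≤s z≤n)
      nonzero e | suc zero | o₀ | o₁ | o₂ with trailFlow-1 ω valid (w (suc zero)) Sign.+ e o₁
      ...   | s , eq rewrite eq | trailFlow-0 ω valid (w zero) Sign.+ e o₀
                           | trailFlow-0 ω valid (w (suc (suc zero))) Sign.+ e o₂ with s
      ...     | Sign.+ = (λ ()) , s≤s (s≤s z≤n)
      ...     | Sign.- = (λ ()) , s≤s (s≤s z≤n)
      nonzero e | suc (suc zero) | o₀ | o₁ | o₂ with trailFlow-1 ω valid (w (suc (suc zero))) Sign.+ e o₂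
      ...   | s , eq rewrite eq | trailFlow-0 ω valid (w zero) Sign.+ e o₀
                           | trailFlow-0 ω valid (w (suc zero)) Sign.+ e o₁ with s
      ...     | Sign.+ = (λ ()) , s≤s (s≤s (s≤s z≤n))
      ...     | Sign.- = (λ ()) , s≤s (s≤s (s≤s z≤n))

    -- The three classes partition the edges, and a sum of three odd numbers is odd.
    total-odd : ¬ (+ 2 ∣ ∑ℤ negative)
    total-odd 2∣N = contradiction 2∣3 (toWitnessFalse {a? = + 2 ∣? + 3} tt)
      where
      N : Fin 3 → ℤ
      N i = ∑trail negative (w i)
      2∣N-1 : ∀ i → + 2 ∣ N i - 1ℤ
      2∣N-1 i = subst (λ s → + 2 ∣ N i - parity s) (odd i) (∑trail-negative (w i))
      n₀ = N zero
      n₁ = N (suc zero)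
      n₂ = N (suc (suc zero))
      o : Fin 3 → Fin nE → ℤ
      o i e = + occ (w i) e
      split : ∀ e → negative e ≡ (o zero e * negative e + o (suc zero) e * negative e) + o (suc (suc zero)) e * negative e
      split e rewrite covers zero e | covers (suc zero) e | covers (suc (suc zero)) e with c e
      ... | zero           = lemma (negative e)
        where
        lemma : ∀ x → x ≡ (1ℤ * x + 0ℤ * x) + 0ℤ * x
        lemma = solve-∀
      ... | suc zero       = lemma (negative e)
        where
        lemma : ∀ x → x ≡ (0ℤ * x + 1ℤ * x) + 0ℤ * x
        lemma = solve-∀
      ... | suc (suc zero) = lemma (negative e)
        where
        lemma : ∀ x → x ≡ (0ℤ * x + 0ℤ * x) + 1ℤ * x
        lemma = solve-∀
      total : ∑ℤ negative ≡ (n₀ + n₁) + n₂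
      total = begin
        ∑ℤ negative
          ≡⟨ ∑ℤ-cong split ⟩
        ∑ℤ (λ e → (o zero e * negative e + o (suc zero) e * negative e) + o (suc (suc zero)) e * negative e)
          ≡⟨ ∑ℤ-+ (λ e → o zero e * negative e + o (suc zero) e * negative e) (λ e → o (suc (suc zero)) e * negative e) ⟩
        ∑ℤ (λ e → o zero e * negative e + o (suc zero) e * negative e) + ∑ℤ (λ e → o (suc (suc zero)) e * negative e)
          ≡⟨ cong₂ _+_ (∑ℤ-+ (λ e → o zero e * negative e) (λ e → o (suc zero) e * negative e)) (∑-occ negative (w (suc (suc zero)))) ⟩
        (∑ℤ (λ e → o zero e * negative e) + ∑ℤ (λ e → o (suc zero) e * negative e)) + n₂
          ≡⟨ cong (_+ n₂) (cong₂ _+_ (∑-occ negative (w zero)) (∑-occ negative (w (suc zero)))) ⟩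
        (n₀ + n₁) + n₂ ∎
        where open ≡-Reasoning
      lemma : ∀ a b c → ((a + b) + c) - (((a - 1ℤ) + (b - 1ℤ)) + (c - 1ℤ)) ≡ + 3
      lemma = solve-∀
      2∣3 : + 2 ∣ + 3
      2∣3 = subst (+ 2 ∣_) (lemma n₀ n₁ n₂) (∣m∣n⇒∣m-n (subst (+ 2 ∣_) total 2∣N)
        (∣m∣n⇒∣m+n (∣m∣n⇒∣m+n (2∣N-1 zero) (2∣N-1 (suc zero))) (2∣N-1 (suc (suc zero)))))

  -- Summing the conservation law over all vertices, each negative edge
  -- contributes ±2 and each positive edge 0.
  ±1-flow⇒even : ∀ ω → ValidOrientation G ω → ∀ ξ → IsFlow G ω ξ → (∀ e → ∃ λ s → ξ e ≡ val s) → + 2 ∣ ∑ℤ negative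
  ±1-flow⇒even ω valid ξ flow units = *-cancelˡ-∣ (+ 2) (subst (+ 4 ∣_) sum≡
    (∑ℤ-∣ (+ 4) (λ e → contribution e + + 2 * negative e) mod-4))
    where
    contribution : Fin nE → ℤ
    contribution e = ξ e * (val (half-sign ω e false) + val (half-sign ω e true))
    ∑δ : ∀ a (x : Fin nV) → ∑ℤ (λ v → a * + δ x v) ≡ a
    ∑δ a x = trans (∑ℤ-* a (λ v → + δ x v)) (trans (cong (a *_) (trans (sym (+-∑ (δ x))) (cong (λ n → + n) (∑-δ x)))) (ℤₚ.*-identityʳ a))
    ∑incidence : ∀ e → ∑ℤ (λ v → ξ e * incidence ω v e) ≡ contribution e
    ∑incidence e = trans (∑ℤ-* (ξ e) (λ v → incidence ω v e)) (cong (ξ e *_)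
      (trans (∑ℤ-+ (λ v → val (half-sign ω e false) * + δ (end e false) v) (λ v → val (half-sign ω e true) * + δ (end e true) v))
        (cong₂ _+_ (∑δ (val (half-sign ω e false)) (end e false)) (∑δ (val (half-sign ω e true)) (end e true)))))
    zero-sum : ∑ℤ contribution ≡ 0ℤ
    zero-sum = trans (∑ℤ-cong (λ e → sym (∑incidence e)))
      (trans (sym (∑ℤ-swap (λ v e → ξ e * incidence ω v e)))
        (trans (∑ℤ-cong (λ v → trans (sym (outflow-incidence ω ξ v)) (flow v))) (∑ℤ-0 nV)))
    sum≡ : ∑ℤ (λ e → contribution e + + 2 * negative e) ≡ + 2 * ∑ℤ negative
    sum≡ = trans (∑ℤ-+ contribution (λ e → + 2 * negative e))
      (trans (cong₂ _+_ zero-sum (∑ℤ-* (+ 2) negative)) (ℤₚ.+-identityˡ (+ 2 * ∑ℤ negative)))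
    -- Adding 2 for a negative edge turns its contribution of 2 or -2 into 4 or 0. Working modulo 4
    -- leaves evenness after the factor 2 is cancelled.
    mod-4 : ∀ e → + 4 ∣ contribution e + + 2 * negative e
    mod-4 e with units e
    ... | s , eq rewrite eq | half-sign-not ω valid e false with σ e | half-sign ω e false | s
    ... | Sign.+ | Sign.+ | Sign.+ = divides 0ℤ refl
    ... | Sign.+ | Sign.+ | Sign.- = divides 0ℤ refl
    ... | Sign.+ | Sign.- | Sign.+ = divides 0ℤ refl
    ... | Sign.+ | Sign.- | Sign.- = divides 0ℤ refl
    ... | Sign.- | Sign.+ | Sign.+ = divides 1ℤ refl
    ... | Sign.- | Sign.+ | Sign.- = divides 0ℤ refl
    ... | Sign.- | Sign.- | Sign.+ = divides 0ℤ refl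
    ... | Sign.- | Sign.- | Sign.- = divides 1ℤ refl

theorem14 : (G : SignedGraph) → Connected G → Eulerian G →
    FlowNumberIs G 3 ⇔ Decomposable G
theorem14 G _ eulerian = mk⇔ to from
  where
  to : FlowNumberIs G 3 → Decomposable G
  to (flow , minimal) with 3-flow⇒ G eulerian flow
  ... | inj₁ 2-flow = contradiction 2-flow (minimal 2 (s≤s (s≤s (s≤s z≤n))))
  ... | inj₂ dec    = dec
  from : Decomposable G → FlowNumberIs G 3
  from (c , v , parts) = decomposable⇒3-flow G c v parts , λ where
    -- For every j below 3, nonzero values of modulus below j are 1 or -1, so one parity argument
    -- excludes all smaller j.
    j (s≤s j≤2) (ω , valid , ξ , flow , nz) → total-odd G c v parts
      (±1-flow⇒even G ω valid ξ flow (λ e → unit (proj₁ (nz e)) (ℕₚ.≤-trans (proj₂ (nz e)) j≤2)))
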